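{- Let $C$ be a cycle on $n$ vertices, let $I, J$ be two $k$-path vertex covers of $C$, and let $u$ be a positive integer. Then one can decide in linear time whether $I$ and $J$ are reconfigurable under $\mathsf{TAR}(u)$.
   Context: Fix an integer $k \geq 2$. A $k$-path is a path on $k$ vertices. A vertex subset $I \subseteq V(G)$ is a $k$-path vertex cover of $G$ if every $k$-path in $G$ contains at least one vertex of $I$. For a positive integer $u$, a sequence $\langle I_0, \dots, I_\ell \rangle$ of $k$-path vertex covers of $G$ is a $\mathsf{TAR}(u)$-sequence between $I_0$ and $I_\ell$ if $|I_i| \le u$ for all $i$ and $|I_i \Delta I_{i+1}| = 1$ for each $i<\ell$. $I$ and $J$ are reconfigurable under $\mathsf{TAR}(u)$ if such a sequence exists between them. -}

module Defs where

open import Data.Bool.Base using (Bool; true; false; if_then_else_)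
open import Data.Fin.Base using (Fin; zero; suc; toℕ; fromℕ; fromℕ<; inject₁)
open import Data.Fin.Permutation using (Permutation′; _⟨$⟩ʳ_)
open import Data.Fin.Subset using (Subset; _∈_; _∪_; _─_; ∣_∣)
open import Data.Nat.Base using (ℕ; zero; suc; _+_; _∸_; _*_; _≤_; _≡ᵇ_)
open import Data.Nat.Properties using (_<?_)
open import Data.Product.Base using (_×_; ∃-syntax)
open import Data.Sum.Base using (_⊎_)
open import Data.Vec.Base using (lookup)
open import Function.Bundles using (_⇔_)
open import Relation.Binary.PropositionalEquality.Core using (_≡_; _≢_)
open import Relation.Nullary using (¬_; yes; no)

record Graph (n : ℕ) : Set₁ where
  field
    Adj    : Fin n → Fin n → Set
    sym    : ∀ {v w} → Adj v w → Adj w v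
    irrefl : ∀ {v} → ¬ Adj v v

open Graph public

Successor : ∀ {n} → Fin n → Fin n → Set
Successor {n} i j =
  (toℕ j ≡ suc (toℕ i)) ⊎ (suc (toℕ i) ≡ n × toℕ j ≡ 0)

-- The vertices can be listed cyclically so that exactly the consecutive ones
-- are adjacent; the listing need not agree with the numbering of `Fin n`.
record IsCycle {n : ℕ} (G : Graph n) : Set where
  field
    3≤n     : 3 ≤ n
    listing : Permutation′ n
    adj⇔    : ∀ i j → Adj G (listing ⟨$⟩ʳ i) (listing ⟨$⟩ʳ j)
                       ⇔ (Successor i j ⊎ Successor j i)

-- Paths are not required to be induced.
record Path {n : ℕ} (G : Graph n) (k : ℕ) : Set where
  field
    vertex    : Fin k → Fin n
    injective : ∀ {i j} → vertex i ≡ vertex j → i ≡ j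
    adjacent  : ∀ {i j} → toℕ j ≡ suc (toℕ i) → Adj G (vertex i) (vertex j)

open Path public

IsPathVertexCover : ∀ {n} → ℕ → Graph n → Subset n → Set
IsPathVertexCover k G I = ∀ (P : Path G k) → ∃[ i ] vertex P i ∈ I

_Δ_ : ∀ {n} → Subset n → Subset n → Subset n
I Δ J = (I ─ J) ∪ (J ─ I)

record TARSequence {n : ℕ} (k : ℕ) (G : Graph n) (u : ℕ)
                   (I J : Subset n) : Set where
  field
    ℓ      : ℕ
    at     : Fin (suc ℓ) → Subset n
    start  : at zero ≡ I
    end    : at (fromℕ ℓ) ≡ J
    covers : ∀ i → IsPathVertexCover k G (at i)
    bound  : ∀ i → ∣ at i ∣ ≤ u
    step   : ∀ (i : Fin ℓ) → ∣ at (inject₁ i) Δ at (suc i) ∣ ≡ 1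

Reconfigurable : ∀ {n} → ℕ → Graph n → ℕ → Subset n → Subset n → Set
Reconfigurable = TARSequence

------------------------------------------------------------------------
-- A random-access machine with unit costs, programmed by structured
-- commands.  A program mentions finitely many registers and arrays, each by a
-- fixed name.  The only operation that increases a number is `inc`, so after
-- t steps every stored number is at most t plus the largest number in the
-- input or the program text: long words cannot be exploited.

record State : Set where
  constructor ⟨_,_⟩
  field
    reg : ℕ → ℕ
    arr : ℕ → ℕ → ℕ

open State public

_[_≔_] : {A : Set} → (ℕ → A) → ℕ → A → (ℕ → A)
(f [ i ≔ a ]) j = if j ≡ᵇ i then a else f j

data Instr : Set where
  const : (r m : ℕ) → Instr     -- r ← m
  move  : (r s : ℕ) → Instr     -- r ← s
  inc   : (r : ℕ) → Instr       -- r ← r + 1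
  sub   : (r s t : ℕ) → Instr   -- r ← s ∸ t
  load  : (r a s : ℕ) → Instr   -- r ← a[s]
  store : (a s r : ℕ) → Instr   -- a[s] ← r

exec : Instr → State → State
exec (const r m)   σ = ⟨ reg σ [ r ≔ m ] , arr σ ⟩
exec (move r s)    σ = ⟨ reg σ [ r ≔ reg σ s ] , arr σ ⟩
exec (inc r)       σ = ⟨ reg σ [ r ≔ suc (reg σ r) ] , arr σ ⟩
exec (sub r s t)   σ = ⟨ reg σ [ r ≔ reg σ s ∸ reg σ t ] , arr σ ⟩
exec (load r a s)  σ = ⟨ reg σ [ r ≔ arr σ a (reg σ s) ] , arr σ ⟩
exec (store a s r) σ =
  ⟨ reg σ , arr σ [ a ≔ arr σ a [ reg σ s ≔ reg σ r ] ] ⟩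

infixr 5 _⨾_

data Program : Set where
  skip       : Program
  instr      : Instr → Program
  _⨾_        : Program → Program → Program
  ifNonZero_then_else_ : ℕ → Program → Program → Program
  whileNonZero_loop_   : ℕ → Program → Program

-- ⟨ P , σ ⟩⇓ τ in t : started in σ, P halts in τ after t unit-cost steps.
-- Each test of a conditional or a loop is a step.
data ⟨_,_⟩⇓_in[_] : Program → State → State → ℕ → Set where
  ⇓skip  : ∀ {σ} → ⟨ skip , σ ⟩⇓ σ in[ 1 ]
  ⇓instr : ∀ {c σ} → ⟨ instr c , σ ⟩⇓ exec c σ in[ 1 ]
  ⇓seq   : ∀ {P Q σ τ υ s t} →
           ⟨ P , σ ⟩⇓ τ in[ s ] → ⟨ Q , τ ⟩⇓ υ in[ t ] →
           ⟨ P ⨾ Q , σ ⟩⇓ υ in[ s + t ]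
  ⇓then  : ∀ {r P Q σ τ t} → reg σ r ≢ 0 → ⟨ P , σ ⟩⇓ τ in[ t ] →
           ⟨ ifNonZero r then P else Q , σ ⟩⇓ τ in[ suc t ]
  ⇓else  : ∀ {r P Q σ τ t} → reg σ r ≡ 0 → ⟨ Q , σ ⟩⇓ τ in[ t ] →
           ⟨ ifNonZero r then P else Q , σ ⟩⇓ τ in[ suc t ]
  ⇓loop  : ∀ {r P σ τ υ s t} → reg σ r ≢ 0 →
           ⟨ P , σ ⟩⇓ τ in[ s ] → ⟨ whileNonZero r loop P , τ ⟩⇓ υ in[ t ] →
           ⟨ whileNonZero r loop P , σ ⟩⇓ υ in[ suc (s + t) ]
  ⇓exit  : ∀ {r P σ} → reg σ r ≡ 0 →
           ⟨ whileNonZero r loop P , σ ⟩⇓ σ in[ 1 ]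

-- The answer is left in register 0: 1 for yes, 0 for no.
Answers : State → Set → Set
Answers σ Q = (reg σ 0 ≡ 1 × Q) ⊎ (reg σ 0 ≡ 0 × ¬ Q)

-- One program and one constant serve all inputs x.
DecidableInLinearTime : ∀ {a} {X : Set a} → (size : X → ℕ) →
                        (input : X → State) → (Q : X → Set) → Set a
DecidableInLinearTime {X = X} size input Q =
  ∃[ P ] ∃[ c ] ∀ (x : X) → ∃[ σ ] ∃[ t ]
    ⟨ P , input x ⟩⇓ σ in[ t ] × t ≤ c * size x × Answers σ (Q x)

------------------------------------------------------------------------

-- On a cycle every adjacency list has two entries, in either order.
record AdjacencyLists {n : ℕ} (G : Graph n) : Set where
  field
    nb₁ nb₂ : Fin n → Fin n
    listed⇔ : ∀ v w → Adj G v w ⇔ (w ≡ nb₁ v ⊎ w ≡ nb₂ v)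

open AdjacencyLists public

record CycleInstance (k : ℕ) : Set₁ where
  field
    n       : ℕ
    C       : Graph n
    isCycle : IsCycle C
    lists   : AdjacencyLists C
    I J     : Subset n
    coverI  : IsPathVertexCover k C I
    coverJ  : IsPathVertexCover k C J
    u       : ℕ
    1≤u     : 1 ≤ u

array : ∀ {n} → (Fin n → ℕ) → ℕ → ℕ
array {n} f i with i <? n
... | yes i<n = f (fromℕ< i<n)
... | no  _   = 0

bit : Bool → ℕ
bit true  = 1
bit false = 0

-- Registers 0 and 1 hold n and u.  Arrays 0 and 1 hold the characteristic
-- vectors of I and J, arrays 2 and 3 the adjacency lists.  All else is 0.
inputState : ∀ {k} → CycleInstance k → State
inputState X = ⟨ registers , arrays ⟩
  where
  open CycleInstance X

  registers : ℕ → ℕ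
  registers 0 = n
  registers 1 = u
  registers _ = 0

  arrays : ℕ → ℕ → ℕ
  arrays 0 = array (λ v → bit (lookup I v))
  arrays 1 = array (λ v → bit (lookup J v))
  arrays 2 = array (λ v → toℕ (nb₁ lists v))
  arrays 3 = array (λ v → toℕ (nb₂ lists v))
  arrays _ = λ _ → 0

ReconfigurableInstance : ∀ {k} → CycleInstance k → Set
ReconfigurableInstance {k} X = Reconfigurable k C u I J
  where open CycleInstance X

module Submission where

-- Write v = u − 1.  If n < k, everything is a cover and the empty set links all
-- covers.  Let k ≤ n and unroll the cycle; a cover is a set meeting every k
-- consecutive vertices, and double counting gives n ≤ k |A| for a cover A.
--
-- If I ∩ J is a cover, I and J are linked through it.  Otherwise a cover of size
-- u with no redundant vertex is stuck, so I and J must both be free: smaller than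
-- u, or with three tokens within k + 1 consecutive vertices (the middle one is
-- then redundant).  A free cover can shrink to size at most v.  If v ≤ 1, two
-- such covers are linked through their union.  If n < v k, a cover containing x
-- can be swept, using one extra token, into {x, x + k, x + 2k, …}; this can be
-- moved to x + 1 by sliding its token at x when k ∤ n, and by adding x + 1 (there
-- is room for one more token) when k ∣ n.  Finally, if v ≥ 2 and v k ≤ n, covers
-- of size v are rotation-invariant by k, so two of them contained in a common set
-- of size v + 1 coincide; along a sequence such a cover is never left, and I ∩ J
-- would contain it.
--
-- All these conditions can be read off two turns round the cycle with a bounded
-- number of counters.

open import Defs hiding (sym)
open import Data.Bool.Base using (Bool; true; false; T; _∧_; _∨_; if_then_else_)
import Data.Bool.Properties as Boolₚ
open import Data.Fin.Base using (Fin; zero; suc; toℕ; fromℕ; fromℕ<; inject₁; opposite)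
import Data.Fin.Permutation as Perm
open import Data.Fin.Permutation using (permutation; _⟨$⟩ʳ_; _⟨$⟩ˡ_)
import Data.Fin.Properties as Finₚ
open import Data.Fin.Subset using (Subset; inside; outside; _∈_; _∉_; _⊆_; _∩_; _∪_; _─_; ∣_∣)
open import Data.Fin.Subset.Properties
open import Data.Nat.Base
open import Data.Nat.Divisibility
open import Data.Nat.DivMod
open import Data.Nat.Properties
open import Data.Product.Base using (_×_; _,_; ∃-syntax; proj₁; proj₂)
open import Data.Sum.Base using (_⊎_; inj₁; inj₂; [_,_]′; swap; map)
open import Data.Unit.Base using (tt)
open import Data.Vec.Base using ([]; _∷_; lookup; _[_]≔_; here; there; tabulate)
open import Data.Vec.Properties
  using ([]≔-updates; []≔-minimal; lookup⇒[]=; []=⇒lookup; lookup∘tabulate; lookup-zipWith)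
open import Function.Base using (_∘_; _$_; id)
open import Function.Bundles using (mk⇔; module Equivalence)
open import Relation.Binary.Construct.Closure.ReflexiveTransitive
  using (Star; ε; _◅_; _◅◅_; gmap; reverse)
open import Relation.Binary.Definitions using (tri<; tri≈; tri>)
open import Relation.Binary.PropositionalEquality hiding (J)
open import Relation.Nullary using (¬_; Dec; does; yes; no; contradiction)
open import Relation.Nullary.Decidable
  using (_×-dec_; _⊎-dec_; ¬?; dec-true; dec-false; does-⇔; from-yes)

open Equivalence using (to; from)
open import Algebra.Properties.CommutativeMonoid.Sum +-0-commutativeMonoid
  using (sum; sum-cong-≗; sum-permute; ∑-comm)

-- The cycle unrolled

-- The obstacle when `2 ≤ v` and `n < v k` is that nothing is known about the shape of a cover. The
-- sweep erases the shape: a token placed at the next multiple of `k` is either there already or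
-- makes an earlier token redundant, so the size never grows. What remains is a single parameter,
-- the starting point, and rotation by one position adjusts it. Two turns are made because a crowded
-- triple or a gap may straddle the starting vertex; for `k ≤ n` each of them fits below position
-- `2 n`. The machine can only increment and subtract. Sizes are therefore compared in doubled form,
-- as two turns deliver them, and the product `k (u − 1)` is replaced by `k` subtractions written
-- into the program, `k` being fixed. The two entries of an adjacency list come in either order, so
-- the machine always takes the neighbour that it did not come from. Its direction is then settled
-- by one list entry and not by the listing in `IsCycle`, which is why windings in both directions
-- are needed.

successor-functional : ∀ {n} {i j j′ : Fin n} → Successor i j → Successor i j′ → j ≡ j′
successor-functional (inj₁ p) (inj₁ q) = Finₚ.toℕ-injective (trans p (sym q))
successor-functional {j = j} (inj₁ p) (inj₂ (q , _)) =
  contradiction (trans p q) (<⇒≢ (Finₚ.toℕ<n j))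
successor-functional {j′ = j′} (inj₂ (p , _)) (inj₁ q) =
  contradiction (trans q p) (<⇒≢ (Finₚ.toℕ<n j′))
successor-functional (inj₂ (_ , p)) (inj₂ (_ , q)) = Finₚ.toℕ-injective (trans p (sym q))

successor-injective : ∀ {n} {i i′ j : Fin n} → Successor i j → Successor i′ j → i ≡ i′
successor-injective (inj₁ p) (inj₁ q) = Finₚ.toℕ-injective (suc-injective (trans (sym p) q))
successor-injective (inj₁ p) (inj₂ (_ , q)) = contradiction (trans (sym q) p) 0≢1+n
successor-injective (inj₂ (_ , p)) (inj₁ q) = contradiction (trans (sym p) q) 0≢1+n
successor-injective (inj₂ (p , _)) (inj₂ (q , _)) =
  Finₚ.toℕ-injective (suc-injective (trans p (sym q)))

opposite-successor : ∀ {n} {i j : Fin n} → Successor i j → Successor (opposite j) (opposite i)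
opposite-successor {suc n} {i} {j} (inj₁ p) = inj₁ (begin
  toℕ (opposite i)        ≡⟨ Finₚ.opposite-prop i ⟩
  n ∸ toℕ i               ≡⟨ +-∸-assoc 1 (≤-pred (subst (_< suc n) p (Finₚ.toℕ<n j))) ⟩
  suc (n ∸ suc (toℕ i))   ≡⟨ cong (λ m → suc (n ∸ m)) p ⟨
  suc (n ∸ toℕ j)         ≡⟨ cong suc (Finₚ.opposite-prop j) ⟨
  suc (toℕ (opposite j))  ∎)
  where open ≡-Reasoning
opposite-successor {suc n} {i} {j} (inj₂ (p , q)) = inj₂
  ( cong suc (trans (Finₚ.opposite-prop j) (cong (n ∸_) q))
  , trans (Finₚ.opposite-prop i) (trans (cong (n ∸_) (suc-injective p)) (n∸n≡0 n)) )

-- Needed when the first edge taken by the machine runs against the given listing.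
reverseCycle : ∀ {n} {G : Graph n} → IsCycle G → IsCycle G
reverseCycle {G = G} c = record
  { 3≤n     = 3≤n
  ; listing = Perm.reverse Perm.∘ₚ listing
  ; adj⇔    = λ i j → mk⇔
      (swap ∘ map undo undo ∘ to (adj⇔ (opposite i) (opposite j)))
      (from (adj⇔ (opposite i) (opposite j)) ∘ swap ∘ map opposite-successor opposite-successor)
  }
  where
  open IsCycle c
  undo : ∀ {i j} → Successor (opposite i) (opposite j) → Successor j i
  undo s = subst₂ Successor (Finₚ.opposite-involutive _) (Finₚ.opposite-involutive _)
             (opposite-successor s)

-- An endless walk round the cycle in one of the two directions.
record Winding {n : ℕ} (G : Graph n) : Set where
  field
    at        : ℕ → Fin n
    periodic  : ∀ i → at (n + i) ≡ at i
    suc-cong  : ∀ i j → at i ≡ at j → at (suc i) ≡ at (suc j)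
    separated : ∀ i d → d < n → at (d + i) ≡ at i → d ≡ 0
    onto      : ∀ v → ∃[ i ] i < n × at i ≡ v
    edge      : ∀ i → Adj G (at i) (at (suc i))
    neighbour : ∀ i {v} → Adj G (at (suc i)) v → v ≡ at i ⊎ v ≡ at (2 + i)

module _ {n : ℕ} .{{_ : NonZero n}} where

  suc-% : ∀ i → suc i % n ≡ suc (i % n) % n
  suc-% i = begin
    suc i % n                        ≡⟨ cong (λ m → suc m % n) (m≡m%n+[m/n]*n i n) ⟩
    (suc (i % n) + (i / n) * n) % n  ≡⟨ [m+kn]%n≡m%n (suc (i % n)) (i / n) n ⟩
    suc (i % n) % n                  ∎
    where open ≡-Reasoning

  toℕ-mod : ∀ i → toℕ (i mod n) ≡ i % n
  toℕ-mod i = Finₚ.toℕ-fromℕ< (m%n<n i n)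

  %⇒mod : ∀ {i j} → i % n ≡ j % n → i mod n ≡ j mod n
  %⇒mod {i} {j} eq = Finₚ.toℕ-injective (trans (toℕ-mod i) (trans eq (sym (toℕ-mod j))))

  mod⇒% : ∀ {i j} → i mod n ≡ j mod n → i % n ≡ j % n
  mod⇒% {i} {j} eq = trans (sym (toℕ-mod i)) (trans (cong toℕ eq) (toℕ-mod j))

  mod-toℕ : ∀ (v : Fin n) → toℕ v mod n ≡ v
  mod-toℕ v = Finₚ.toℕ-injective (trans (toℕ-mod (toℕ v)) (m<n⇒m%n≡m (Finₚ.toℕ<n v)))

  mod-successor : ∀ i → Successor (i mod n) (suc i mod n)
  mod-successor i with suc (i % n) <? n
  ... | yes lt = inj₁ (trans (toℕ-mod (suc i)) (trans (suc-% i)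
                   (trans (m<n⇒m%n≡m lt) (cong suc (sym (toℕ-mod i))))))
  ... | no ¬lt = inj₂ (trans (cong suc (toℕ-mod i)) eq ,
                   trans (toℕ-mod (suc i)) (trans (suc-% i) (trans (cong (_% n) eq) (n%n≡0 n))))
    where eq = ≤-antisym (m%n<n i n) (≮⇒≥ ¬lt)

  -- The number `d + i % n` is below `2 n`. Either it is its own residue and cancellation gives
  -- `d ≡ 0`, or subtracting `n` once gives its residue and cancellation yields `d ≡ n`, which
  -- `d < n` excludes.
  [d+i]%n≡i%n⇒d≡0 : ∀ i d → d < n → (d + i) % n ≡ i % n → d ≡ 0
  [d+i]%n≡i%n⇒d≡0 i d d<n eq with d + i % n <? n
  ... | yes lt = +-cancelʳ-≡ (i % n) d 0 $ begin
      d + i % n                      ≡⟨ m<n⇒m%n≡m lt ⟨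
      (d + i % n) % n                ≡⟨ [m+kn]%n≡m%n (d + i % n) (i / n) n ⟨
      (d + i % n + i / n * n) % n    ≡⟨ cong (_% n) (+-assoc d (i % n) (i / n * n)) ⟩
      (d + (i % n + i / n * n)) % n  ≡⟨ cong (λ m → (d + m) % n) (m≡m%n+[m/n]*n i n) ⟨
      (d + i) % n                    ≡⟨ eq ⟩
      i % n                          ∎
    where open ≡-Reasoning
  ... | no ¬lt = contradiction d≡n (<⇒≢ d<n)
    where
    open ≡-Reasoning
    n≤ = ≮⇒≥ ¬lt
    small : d + i % n ∸ n < n
    small = +-cancelˡ-< n _ _ (subst (_< n + n) (sym (m+[n∸m]≡n n≤)) (+-mono-< d<n (m%n<n i n)))
    d≡n : d ≡ n
    d≡n = +-cancelʳ-≡ (i % n) d n $ begin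
      d + i % n                    ≡⟨ m+[n∸m]≡n n≤ ⟨
      n + (d + i % n ∸ n)          ≡⟨ cong (n +_) (m<n⇒m%n≡m small) ⟨
      n + (d + i % n ∸ n) % n      ≡⟨ cong (n +_) (m≤n⇒[n∸m]%m≡n%m n≤) ⟩
      n + (d + i % n) % n          ≡⟨ cong (n +_) ([m+kn]%n≡m%n (d + i % n) (i / n) n) ⟨
      n + (d + i % n + i / n * n) % n    ≡⟨ cong (λ m → n + m % n) (+-assoc d (i % n) (i / n * n)) ⟩
      n + (d + (i % n + i / n * n)) % n  ≡⟨ cong (λ m → n + (d + m) % n) (m≡m%n+[m/n]*n i n) ⟨
      n + (d + i) % n              ≡⟨ cong (n +_) eq ⟩
      n + i % n                    ∎

listingWinding : ∀ {n} {G : Graph n} → IsCycle G → Winding G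
listingWinding {n} {G} c = record
  { at        = e
  ; periodic  = λ i → cong (listing ⟨$⟩ʳ_) (%⇒mod (trans (cong (_% n) (+-comm n i)) ([m+n]%n≡m%n i n)))
  ; suc-cong  = λ i j eq → cong (listing ⟨$⟩ʳ_) (%⇒mod (trans (suc-% {n} i)
      (trans (cong (λ m → suc m % n) (mod⇒% (listing-injective eq))) (sym (suc-% {n} j)))))
  ; separated = λ i d d<n eq → [d+i]%n≡i%n⇒d≡0 i d d<n (mod⇒% (listing-injective eq))
  ; onto      = λ v → toℕ (listing ⟨$⟩ˡ v) , Finₚ.toℕ<n _ ,
      trans (cong (listing ⟨$⟩ʳ_) (mod-toℕ _)) (Perm.inverseʳ listing)
  ; edge      = λ i → from (adj⇔ _ _) (inj₁ (mod-successor i))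
  ; neighbour = λ i {v} adj →
      map (λ s → position v (successor-injective s (mod-successor i)))
          (λ s → position v (successor-functional s (mod-successor (suc i))))
        (swap (to (adj⇔ _ _) (subst (Adj G _) (sym (Perm.inverseʳ listing)) adj)))
  }
  where
  open IsCycle c
  instance
    n≢0 : NonZero n
    n≢0 = >-nonZero (≤-trans (s≤s z≤n) 3≤n)
  e : ℕ → Fin n
  e i = listing ⟨$⟩ʳ (i mod n)
  listing-injective : ∀ {i j} → listing ⟨$⟩ʳ i ≡ listing ⟨$⟩ʳ j → i ≡ j
  listing-injective eq = trans (sym (Perm.inverseˡ listing))
                   (trans (cong (listing ⟨$⟩ˡ_) eq) (Perm.inverseˡ listing))
  position : ∀ v {i} → listing ⟨$⟩ˡ v ≡ i → v ≡ listing ⟨$⟩ʳ i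
  position v refl = sym (Perm.inverseʳ listing)

-- Only `onto` needs care: the vertex at the dropped position 0 is found again one full turn later,
-- at old position `n`.
shift : ∀ {n} {G : Graph n} → Winding G → Winding G
shift {zero} W = W
shift {n@(suc n-1)} W = record
  { at        = at ∘ suc
  ; periodic  = λ i → trans (cong at (sym (+-suc n i))) (periodic (suc i))
  ; suc-cong  = λ i j → suc-cong (suc i) (suc j)
  ; separated = λ i d d<n eq → separated (suc i) d d<n (trans (cong at (+-suc d i)) eq)
  ; onto      = onto′
  ; edge      = edge ∘ suc
  ; neighbour = neighbour ∘ suc
  }
  where
  open Winding W
  onto′ : ∀ v → ∃[ i ] i < n × at (suc i) ≡ v
  onto′ v with onto v
  ... | suc i , i<n , eq = i , <-trans (n<1+n i) i<n , eq
  ... | zero  , _   , eq = n-1 , n<1+n n-1 ,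
          trans (cong at (sym (+-identityʳ n))) (trans (periodic 0) eq)

shiftBy : ∀ {n} {G : Graph n} → ℕ → Winding G → Winding G
shiftBy zero    W = W
shiftBy (suc m) W = shift (shiftBy m W)

at-shift : ∀ {n} {G : Graph n} (W : Winding G) i → Winding.at (shift W) i ≡ Winding.at W (suc i)
at-shift {zero}  W i with () ← Winding.at W 0
at-shift {suc _} W i = refl

at-shiftBy : ∀ {n} {G : Graph n} m (W : Winding G) i →
             Winding.at (shiftBy m W) i ≡ Winding.at W (m + i)
at-shiftBy zero    W i = refl
at-shiftBy (suc m) W i = trans (at-shift (shiftBy m W) i)
  (trans (at-shiftBy m W (suc i)) (cong (Winding.at W) (+-suc m i)))

-- The place of `v` in the listing tells how far to shift; whether `w` comes after or before it
-- tells which of the two directions to take.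
windingAlong : ∀ {n} {G : Graph n} → IsCycle G → ∀ {v w} → Adj G v w →
               ∃[ W ] Winding.at {G = G} W 0 ≡ v × Winding.at W 1 ≡ w
windingAlong {n} {G} c {v} {w} adj =
  [ along c
  , (λ s → along (reverseCycle c) (opposite-successor s))
  ]′ (to (IsCycle.adj⇔ c _ _) (subst₂ (Adj G) (sym (Perm.inverseʳ (IsCycle.listing c)))
                                              (sym (Perm.inverseʳ (IsCycle.listing c))) adj))
  where
  along : (c : IsCycle G) → let open IsCycle c in
          Successor (listing ⟨$⟩ˡ v) (listing ⟨$⟩ˡ w) →
          ∃[ W ] Winding.at {G = G} W 0 ≡ v × Winding.at W 1 ≡ w
  along c s = shiftBy m W , trans (at-shiftBy m W 0) (trans (cong at (+-identityʳ m)) start) ,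
    trans (at-shiftBy m W 1) (trans (cong at (+-comm m 1)) next)
    where
    open IsCycle c
    instance
      n≢0 : NonZero n
      n≢0 = >-nonZero (≤-trans (s≤s z≤n) 3≤n)
    W = listingWinding c
    open Winding W
    m = toℕ (listing ⟨$⟩ˡ v)
    start : at m ≡ v
    start = trans (cong (listing ⟨$⟩ʳ_) (mod-toℕ _)) (Perm.inverseʳ listing)
    next : at (suc m) ≡ w
    next = trans (cong (listing ⟨$⟩ʳ_) (successor-functional
             (subst (λ i → Successor i (suc m mod n)) (mod-toℕ _) (mod-successor m)) s))
             (Perm.inverseʳ listing)

-- Reconfiguration sequences

∣pΔp∣≡0 : ∀ {n} (p : Subset n) → ∣ p Δ p ∣ ≡ 0
∣pΔp∣≡0 []          = refl
∣pΔp∣≡0 (true ∷ p)  = ∣pΔp∣≡0 p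
∣pΔp∣≡0 (false ∷ p) = ∣pΔp∣≡0 p

∣pΔq∣≡0⇒p≡q : ∀ {n} (p q : Subset n) → ∣ p Δ q ∣ ≡ 0 → p ≡ q
∣pΔq∣≡0⇒p≡q []          []          _ = refl
∣pΔq∣≡0⇒p≡q (true ∷ p)  (true ∷ q)  e = cong (true ∷_) (∣pΔq∣≡0⇒p≡q p q e)
∣pΔq∣≡0⇒p≡q (false ∷ p) (false ∷ q) e = cong (false ∷_) (∣pΔq∣≡0⇒p≡q p q e)

Δ-comm : ∀ {n} (p q : Subset n) → p Δ q ≡ q Δ p
Δ-comm p q = ∪-comm (p ─ q) (q ─ p)

∣pΔq∣≡1⇒nested : ∀ {n} (p q : Subset n) → ∣ p Δ q ∣ ≡ 1 →
                 (p ⊆ q × ∣ q ∣ ≡ suc ∣ p ∣) ⊎ (q ⊆ p × ∣ p ∣ ≡ suc ∣ q ∣)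
∣pΔq∣≡1⇒nested []          []          ()
∣pΔq∣≡1⇒nested (true ∷ p)  (true ∷ q)  e with ∣pΔq∣≡1⇒nested p q e
... | inj₁ (p⊆q , eq) = inj₁ (s⊆s p⊆q , cong suc eq)
... | inj₂ (q⊆p , eq) = inj₂ (s⊆s q⊆p , cong suc eq)
∣pΔq∣≡1⇒nested (false ∷ p) (false ∷ q) e with ∣pΔq∣≡1⇒nested p q e
... | inj₁ (p⊆q , eq) = inj₁ (s⊆s p⊆q , eq)
... | inj₂ (q⊆p , eq) = inj₂ (s⊆s q⊆p , eq)
∣pΔq∣≡1⇒nested (true ∷ p)  (false ∷ q) e with refl ← ∣pΔq∣≡0⇒p≡q p q (suc-injective e) =
  inj₂ (out⊆ id , refl)
∣pΔq∣≡1⇒nested (false ∷ p) (true ∷ q)  e with refl ← ∣pΔq∣≡0⇒p≡q p q (suc-injective e) =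
  inj₁ (out⊆ id , refl)

Removal : ∀ {n} → Subset n → Subset n → Set
Removal p q = q ⊆ p × ∣ p Δ q ∣ ≡ 1

∷-removal : ∀ {n} b {p q : Subset n} → Removal p q → Removal (b ∷ p) (b ∷ q)
∷-removal true  (q⊆p , e) = s⊆s q⊆p , e
∷-removal false (q⊆p , e) = s⊆s q⊆p , e

removals : ∀ {n} (p q : Subset n) → q ⊆ p → Star Removal p q
removals []          []          _   = ε
removals (true ∷ p)  (true ∷ q)  q⊆p =
  gmap (true ∷_) (∷-removal _) (removals p q (drop-∷-⊆ q⊆p))
removals (false ∷ p) (false ∷ q) q⊆p =
  gmap (false ∷_) (∷-removal _) (removals p q (drop-∷-⊆ q⊆p))
removals (true ∷ p)  (false ∷ q) q⊆p =
  gmap (true ∷_) (∷-removal _) (removals p q (drop-∷-⊆ q⊆p))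
    ◅◅ ((out⊆ id , cong suc (∣pΔp∣≡0 q)) ◅ ε)
removals (false ∷ p) (true ∷ q)  q⊆p with () ← q⊆p here

module Reconfiguration {n : ℕ} (k : ℕ) (G : Graph n) (u : ℕ) where

  Cover : Subset n → Set
  Cover = IsPathVertexCover k G

  cover-⊆ : ∀ {A B} → A ⊆ B → Cover A → Cover B
  cover-⊆ A⊆B cover P with i , i∈A ← cover P = i , A⊆B i∈A

  Valid : Subset n → Set
  Valid A = Cover A × ∣ A ∣ ≤ u

  Step : Subset n → Subset n → Set
  Step A B = Valid A × Valid B × ∣ A Δ B ∣ ≡ 1

  infix 4 _~_
  _~_ : Subset n → Subset n → Set
  _~_ = Star Step

  ~-sym : ∀ {A B} → A ~ B → B ~ A
  ~-sym = reverse λ {A} {B} (a , b , e) → b , a , trans (cong ∣_∣ (Δ-comm B A)) e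

  sequence⇒~ : ∀ {A B} → TARSequence k G u A B → A ~ B
  sequence⇒~ S = subst₂ _~_ start end
      (go ℓ at (λ i → covers i , bound i) step)
    where
    open TARSequence S
    go : ∀ ℓ (at : Fin (suc ℓ) → Subset n) → (∀ i → Valid (at i)) →
         (∀ (i : Fin ℓ) → ∣ at (inject₁ i) Δ at (suc i) ∣ ≡ 1) → at zero ~ at (fromℕ ℓ)
    go zero    at valid step = ε
    go (suc ℓ) at valid step = (valid zero , valid (suc zero) , step zero)
      ◅ go ℓ (at ∘ suc) (valid ∘ suc) (step ∘ suc)

  ~⇒sequence : ∀ {A B} → Valid A → A ~ B → TARSequence k G u A B
  ~⇒sequence {A} (cover , size) ε = record
    { ℓ = 0 ; at = λ _ → A ; start = refl ; end = refl
    ; covers = λ _ → cover ; bound = λ _ → size ; step = λ () }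
  ~⇒sequence {A} (cover , size) ((_ , valid , e) ◅ rest) = record
    { ℓ      = suc ℓ
    ; at     = λ { zero → A ; (suc i) → at i }
    ; start  = refl
    ; end    = end
    ; covers = λ { zero → cover ; (suc i) → covers i }
    ; bound  = λ { zero → size ; (suc i) → bound i }
    ; step   = λ { zero → trans (cong (λ X → ∣ A Δ X ∣) start) e ; (suc i) → step i }
    }
    where open TARSequence (~⇒sequence valid rest)

  -- Tokens are removed one at a time. Every set on the way contains `B`, hence is a cover, and lies
  -- in `A`, hence respects the bound.
  ⊇⇒~ : ∀ {A B} → B ⊆ A → Cover B → ∣ A ∣ ≤ u → A ~ B
  ⊇⇒~ {A} {B} B⊆A cover size = go (removals A B B⊆A) size
    where
    below : ∀ {X} → Star Removal X B → B ⊆ X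
    below ε              = id
    below ((Y⊆X , _) ◅ r) = Y⊆X ∘ below r
    go : ∀ {X} → Star Removal X B → ∣ X ∣ ≤ u → X ~ B
    go ε _ = ε
    go r@((Y⊆X , e) ◅ r′) size =
      ((cover-⊆ (below r) cover , size) , (cover-⊆ (below r′) cover , size′) , e) ◅ go r′ size′
      where size′ = ≤-trans (p⊆q⇒∣p∣≤∣q∣ Y⊆X) size

  -- The form in which exchanges of tokens enter: up to `C`, then down again.
  common-superset⇒~ : ∀ {A B} C → A ⊆ C → B ⊆ C → ∣ C ∣ ≤ u → Cover A → Cover B → A ~ B
  common-superset⇒~ C A⊆C B⊆C size coverA coverB =
    ~-sym (⊇⇒~ A⊆C coverA size) ◅◅ ⊇⇒~ B⊆C coverB size

  common-subcover⇒~ : ∀ {A B} → Cover (A ∩ B) → ∣ A ∣ ≤ u → ∣ B ∣ ≤ u → A ~ B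
  common-subcover⇒~ {A} {B} cover sizeA sizeB =
    ⊇⇒~ (p∩q⊆p A B) cover sizeA ◅◅ ~-sym (⊇⇒~ (p∩q⊆q A B) cover sizeB)

-- Inserting and deleting a single token

∈-insert : ∀ {n} (p : Subset n) x → x ∈ p [ x ]≔ inside
∈-insert p x = []≔-updates p x

∉-delete : ∀ {n} (p : Subset n) x → x ∉ p [ x ]≔ outside
∉-delete p x x∈ with () ← trans (sym ([]=⇒lookup x∈)) ([]=⇒lookup ([]≔-updates p x))

⊆-insert : ∀ {n} (p : Subset n) x → p ⊆ p [ x ]≔ inside
⊆-insert p x {y} y∈p with y Finₚ.≟ x
... | yes refl = ∈-insert p x
... | no  y≢x  = []≔-minimal p y x y≢x y∈p

∈-insert⁻ : ∀ {n} (p : Subset n) x {y} → y ∈ p [ x ]≔ inside → y ≢ x → y ∈ p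
∈-insert⁻ (_ ∷ p) zero    here       y≢x = contradiction refl y≢x
∈-insert⁻ (_ ∷ p) zero    (there y∈) y≢x = there y∈
∈-insert⁻ (_ ∷ p) (suc x) here       y≢x = here
∈-insert⁻ (_ ∷ p) (suc x) (there y∈) y≢x = there (∈-insert⁻ p x y∈ (y≢x ∘ cong suc))

∈-delete : ∀ {n} (p : Subset n) x {y} → y ∈ p → y ≢ x → y ∈ p [ x ]≔ outside
∈-delete p x y∈p y≢x = []≔-minimal p _ x y≢x y∈p

delete-⊆ : ∀ {n} (p : Subset n) x → p [ x ]≔ outside ⊆ p
delete-⊆ (_ ∷ p) zero    (there y∈) = there y∈
delete-⊆ (_ ∷ p) (suc x) here       = here
delete-⊆ (_ ∷ p) (suc x) (there y∈) = there (delete-⊆ p x y∈)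

∣insert∣≤ : ∀ {n} (p : Subset n) x → ∣ p [ x ]≔ inside ∣ ≤ suc ∣ p ∣
∣insert∣≤ (true  ∷ p) zero    = n≤1+n _
∣insert∣≤ (false ∷ p) zero    = ≤-refl
∣insert∣≤ (true  ∷ p) (suc x) = s≤s (∣insert∣≤ p x)
∣insert∣≤ (false ∷ p) (suc x) = ∣insert∣≤ p x

∣p∪q∣≤∣p∣+∣q∣ : ∀ {n} (p q : Subset n) → ∣ p ∪ q ∣ ≤ ∣ p ∣ + ∣ q ∣
∣p∪q∣≤∣p∣+∣q∣ []          []          = z≤n
∣p∪q∣≤∣p∣+∣q∣ (true  ∷ p) (true  ∷ q) =
  s≤s (≤-trans (∣p∪q∣≤∣p∣+∣q∣ p q) (+-monoʳ-≤ ∣ p ∣ (n≤1+n _)))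
∣p∪q∣≤∣p∣+∣q∣ (true  ∷ p) (false ∷ q) = s≤s (∣p∪q∣≤∣p∣+∣q∣ p q)
∣p∪q∣≤∣p∣+∣q∣ (false ∷ p) (true  ∷ q) =
  ≤-trans (s≤s (∣p∪q∣≤∣p∣+∣q∣ p q)) (≤-reflexive (sym (+-suc ∣ p ∣ ∣ q ∣)))
∣p∪q∣≤∣p∣+∣q∣ (false ∷ p) (false ∷ q) = ∣p∪q∣≤∣p∣+∣q∣ p q

-- Covers in terms of positions on the unrolled cycle

module Positions {n : ℕ} .{{_ : NonZero n}} {G : Graph n} (W : Winding G) where
  open Winding W

  at-periodic : ∀ m i → at (m * n + i) ≡ at i
  at-periodic zero    i = refl
  at-periodic (suc m) i = trans (cong at (+-assoc n (m * n) i)) (trans (periodic _) (at-periodic m i))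

  at-cong : ∀ d {i j} → at i ≡ at j → at (d + i) ≡ at (d + j)
  at-cong zero    eq = eq
  at-cong (suc d) eq = suc-cong _ _ (at-cong d eq)

  -- Walking `d * n ∸ d` positions further completes `d` full turns on both sides, so no step
  -- backwards is required.
  at-cancel : ∀ d {i j} → at (d + i) ≡ at (d + j) → at i ≡ at j
  at-cancel d {i} {j} eq = trans (sym (around i)) (trans (at-cong (d * n ∸ d) eq) (around j))
    where
    around : ∀ i → at (d * n ∸ d + (d + i)) ≡ at i
    around i = trans (cong at (trans (sym (+-assoc (d * n ∸ d) d i))
                 (cong (_+ i) (m∸n+n≡m (m≤m*n d n))))) (at-periodic d i)

  apart : ∀ {i j} → i < j → j < n + i → at i ≢ at j
  apart {i} {j} i<j j<n+i eq = contradiction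
    (separated i (j ∸ i) (+-cancelʳ-< i _ n (subst (_< n + i) (sym j∸i+i≡j) j<n+i))
      (trans (cong at j∸i+i≡j) (sym eq)))
    (m>n⇒m∸n≢0 i<j)
    where j∸i+i≡j = m∸n+n≡m (<⇒≤ i<j)

  at-injective : ∀ {i j} → i < n → j < n → at i ≡ at j → i ≡ j
  at-injective {i} {j} i<n j<n eq with <-cmp i j
  ... | tri< i<j _ _ = contradiction eq (apart i<j (m≤n⇒m≤n+o i j<n))
  ... | tri≈ _ i≡j _ = i≡j
  ... | tri> _ _ j<i = contradiction (sym eq) (apart j<i (m≤n⇒m≤n+o j i<n))

  onto-from : ∀ s v → ∃[ i ] i < n × at (s + i) ≡ v
  onto-from s v with i , i<n , eq ← Winding.onto (shiftBy s W) v =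
    i , i<n , trans (sym (at-shiftBy s W i)) eq

  position : Fin n → ℕ
  position v = proj₁ (onto v)

  position<n : ∀ v → position v < n
  position<n v = proj₁ (proj₂ (onto v))

  at-position : ∀ v → at (position v) ≡ v
  at-position v = proj₂ (proj₂ (onto v))

  position-at : ∀ {i} → i < n → position (at i) ≡ i
  position-at i<n = at-injective (position<n _) i<n (at-position _)

  module _ {P : ℕ → Set} (P? : ∀ i → Dec (P i)) where

    select : Subset n
    select = tabulate (λ v → does (P? (position v)))

    select⁺ : ∀ {i} → i < n → P i → at i ∈ select
    select⁺ {i} i<n p = lookup⇒[]= _ _ (trans (lookup∘tabulate _ (at i))
      (dec-true (P? _) (subst P (sym (position-at i<n)) p)))

    select⁻ : ∀ {v} → v ∈ select → P (position v)
    select⁻ {v} v∈ with P? (position v) | trans (sym (lookup∘tabulate _ v)) ([]=⇒lookup v∈)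
    ... | yes p | _ = p

  Hit : ℕ → Subset n → ℕ → Set
  Hit k A i = ∃[ j ] j < k × at (j + i) ∈ A

  hit-everywhere : ∀ {k A} → (∀ i → i < n → Hit k A i) → ∀ i → Hit k A i
  hit-everywhere hit i with r , r<n , eq ← onto (at i) with j , j<k , j∈ ← hit r r<n =
    j , j<k , subst (_∈ _) (at-cong j eq) j∈

  module _ {k : ℕ} (k≤n : k ≤ n) {A : Subset n} where

    -- By `k ≤ n` a window of `k` positions does not overlap itself, so it is a path.
    cover⇒hit : IsPathVertexCover k G A → ∀ i → Hit k A i
    cover⇒hit cover i = let j , j∈ = cover window in toℕ j , Finₚ.toℕ<n j , j∈
      where
      window : Path G k
      window = record
        { vertex    = λ j → at (toℕ j + i)
        ; injective = λ {a} {b} eq → Finₚ.toℕ-injective (at-injective (bound a) (bound b)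
            (at-cancel i (subst₂ (λ x y → at x ≡ at y) (+-comm (toℕ a) i) (+-comm (toℕ b) i) eq)))
        ; adjacent  = λ {a} {b} eq → subst (λ m → Adj G (at (toℕ a + i)) (at (m + i))) (sym eq) (edge _)
        }
        where
        bound : ∀ (j : Fin k) → toℕ j < n
        bound j = ≤-trans (Finₚ.toℕ<n j) k≤n

  -- A path of the cycle follows the winding or runs against it.
  module _ {k-2 : ℕ} (P : Path G (2 + k-2)) where

    private
      k L : ℕ
      k = 2 + k-2
      L = suc k-2

      p : ℕ → Fin n
      p i = vertex P (i mod k)

      toℕ-index : ∀ {i} → i < k → toℕ (i mod k) ≡ i
      toℕ-index {i} i<k = trans (toℕ-mod i) (m<n⇒m%n≡m i<k)

      p-adjacent : ∀ {i} → suc i < k → Adj G (p i) (p (suc i))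
      p-adjacent {i} lt = adjacent P (trans (toℕ-index lt) (cong suc (sym (toℕ-index (<-trans (n<1+n i) lt)))))

      p-straight : ∀ {i} → suc (suc i) < k → p (suc (suc i)) ≢ p i
      p-straight {i} lt eq = contradiction
        (trans (sym (toℕ-index lt)) (trans (cong toℕ (injective P eq))
          (toℕ-index (<-trans (n<1+n i) (<-trans (n<1+n _) lt)))))
        (≢-sym (<⇒≢ (m≤n+m (suc i) 1)))

    -- A path cannot return to the vertex it has just left, so of the two options in `neighbour`
    -- only the one straight ahead survives.
    forward : ∀ {s} → p 0 ≡ at s → p 1 ≡ at (suc s) → ∀ i → suc i < k →
              p i ≡ at (i + s) × p (suc i) ≡ at (suc i + s)
    forward p₀ p₁ zero    _  = p₀ , p₁
    forward {s} p₀ p₁ (suc i) lt with q , q′ ← forward p₀ p₁ i (<-trans (n<1+n _) lt)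
      with neighbour (i + s) (subst (λ v → Adj G v _) q′ (p-adjacent lt))
    ... | inj₁ e = contradiction (trans e (sym q)) (p-straight lt)
    ... | inj₂ e = q′ , e

    -- The index `j` counts down while `i` counts up; the equation between them replaces subtraction
    -- in the positions, which run from `L + s` down to `s`.
    backward : ∀ {s} → p 0 ≡ at (L + s) → p 1 ≡ at (k-2 + s) → ∀ i j → suc i + j ≡ L →
               p i ≡ at (suc j + s) × p (suc i) ≡ at (j + s)
    backward p₀ p₁ zero    j refl = p₀ , p₁
    backward {s} p₀ p₁ (suc i) j eq with q , q′ ← backward p₀ p₁ i (suc j) (trans (+-suc (suc i) j) eq)
      with neighbour (j + s) (subst (λ v → Adj G v _) q′ (p-adjacent lt))
      where
      lt : suc (suc i) < k
      lt = s≤s (subst (suc (suc i) ≤_) eq (m≤m+n _ j))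
    ... | inj₁ e = q′ , e
    ... | inj₂ e = contradiction (trans e (sym q)) (p-straight (s≤s (subst (suc (suc i) ≤_) eq (m≤m+n _ j))))

    visits-window : ∃[ s ] ∀ j → j < k → ∃[ i ] vertex P i ≡ at (j + s)
    -- The path is located `k` turns up the winding, so that one running backwards does not fall
    -- below position 0. The extra 1 gives the starting vertex the form `at (suc _)` that
    -- `neighbour` expects.
    visits-window with b , b<n , start ← onto-from (k * n + 1) (p 0)
      with neighbour (k * n + b) (subst (λ v → Adj G v (p 1))
             (trans (sym start) (cong at (trans (+-assoc (k * n) 1 b) (+-suc (k * n) b))))
             (p-adjacent {0} (s≤s (s≤s z≤n))))
    ... | inj₂ p₁ = suc (k * n + b) , λ
        { zero    _  → 0 mod k , p₀
        ; (suc j) lt → suc j mod k , proj₂ (forward p₀ p₁ j lt) }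
      where
      p₀ : p 0 ≡ at (suc (k * n + b))
      p₀ = trans (sym start) (cong at (trans (+-assoc (k * n) 1 b) (+-suc (k * n) b)))
    ... | inj₁ p₁ = s , visit
      where
      s = k * n + b ∸ k-2
      k-2+s : k-2 + s ≡ k * n + b
      k-2+s = m+[n∸m]≡n (≤-trans (≤-trans (m≤n+m k-2 2) (m≤m*n k n)) (m≤m+n (k * n) b))
      p₀ : p 0 ≡ at (L + s)
      p₀ = trans (sym start) (cong at (trans (+-assoc (k * n) 1 b)
             (trans (+-suc (k * n) b) (cong suc (sym k-2+s)))))
      visit : ∀ j → j < k → ∃[ i ] vertex P i ≡ at (j + s)
      visit zero    _ = suc k-2 mod k , proj₂ (backward p₀ (trans p₁ (cong at (sym k-2+s))) k-2 0 (+-identityʳ _))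
      visit (suc j) (s≤s (s≤s j≤)) = (k-2 ∸ j) mod k , proj₁ (backward p₀ (trans p₁ (cong at (sym k-2+s)))
        (k-2 ∸ j) j (cong suc (m∸n+n≡m j≤)))

  hit⇒cover : ∀ {k A} → 2 ≤ k → (∀ i → Hit k A i) → IsPathVertexCover k G A
  hit⇒cover (s≤s (s≤s _)) hit P with s , visit ← visits-window P with j , j<k , j∈ ← hit s
    with i , eq ← visit j j<k = i , subst (_∈ _) (sym eq) j∈

-- Sweeping a cover into the multiples of k

-- When the window moves on by one and loses the multiple `i`, it gains `k + i`.
multiple-in-window : ∀ k .{{_ : NonZero k}} i → ∃[ m ] k ∣ m × i ≤ m × m < k + i
multiple-in-window k zero    = 0 , k ∣0 , z≤n , subst (0 <_) (sym (+-identityʳ k)) (>-nonZero⁻¹ k)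
multiple-in-window k (suc i) with m , k∣m , i≤m , m< ← multiple-in-window k i with m≤n⇒m<n∨m≡n i≤m
... | inj₁ i<m  = m , k∣m , i<m , <-≤-trans m< (+-monoʳ-≤ k (n≤1+n i))
... | inj₂ refl = k + i , ∣m∣n⇒∣m+n ∣-refl k∣m , +-monoˡ-≤ i (>-nonZero⁻¹ k) , +-monoʳ-< k (n<1+n i)

multiple<[1+j]k⇒≤jk : ∀ {k m j} .{{_ : NonZero k}} → k ∣ m → m < suc j * k → m ≤ j * k
multiple<[1+j]k⇒≤jk {k} {m} {j} (divides q refl) lt = *-monoˡ-≤ k (≤-pred (*-cancelʳ-< k q (suc j) lt))

module Connectivity {n : ℕ} .{{_ : NonZero n}} {G : Graph n}
                    {k : ℕ} (2≤k : 2 ≤ k) (k≤n : k ≤ n) (v : ℕ) where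

  open Reconfiguration k G (suc v) public

  private instance
    k≢0 : NonZero k
    k≢0 = >-nonZero (≤-trans (s≤s z≤n) 2≤k)

  offset : ∀ {i p} → i ≤ p → p < k + i → ∃[ j ] j < k × j + i ≡ p
  offset {i} {p} i≤p p<k+i =
    p ∸ i , +-cancelʳ-< i _ k (subst (_< k + i) (sym (m∸n+n≡m i≤p)) p<k+i) , m∸n+n≡m i≤p

  module Multiples (W : Winding G) where
    open Winding W
    open Positions W

    hit-at : ∀ {A i p} → i ≤ p → p < k + i → at p ∈ A → Hit k A i
    hit-at {A} i≤p p<k+i p∈ with j , j<k , refl ← offset i≤p p<k+i = j , j<k , p∈

    at-n : at n ≡ at 0
    at-n = trans (cong at (sym (+-identityʳ n))) (periodic 0)

    at-1+n : at (suc n) ≡ at 1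
    at-1+n = trans (cong at (+-comm 1 n)) (periodic 1)

    multiples : Subset n
    multiples = select (k ∣?_)

    module Sweep {A : Subset n} (coverA : Cover A) (0∈A : at 0 ∈ A) where

      -- Positions of the tokens when the sweep has passed position j k.
      Stage : ℕ → ℕ → Set
      Stage j i = (i ≤ j * k × k ∣ i) ⊎ (j * k < i × at i ∈ A)

      stage? : ∀ j i → Dec (Stage j i)
      stage? j i = (i ≤? j * k ×-dec k ∣? i) ⊎-dec (j * k <? i ×-dec at i ∈? A)

      stage : ℕ → Subset n
      stage j = select (stage? j)

      stage⁺ : ∀ j {i} → i < n → Stage j i → at i ∈ stage j
      stage⁺ j = select⁺ (stage? j)

      stage⁻ : ∀ j {x} → x ∈ stage j → Stage j (position x)
      stage⁻ j = select⁻ (stage? j)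

      0∈stage : ∀ j → at 0 ∈ stage j
      0∈stage j = stage⁺ j (>-nonZero⁻¹ n) (inj₁ (z≤n , k ∣0))

      -- A window containing position `n` is met by the token at 0. Of the others, one starting at
      -- most at `j k` contains a multiple of `k` that is at most `j k`, and one starting later sees
      -- only positions at which the stage agrees with `A`.
      stage-cover : ∀ j → Cover (stage j)
      stage-cover j = hit⇒cover 2≤k (hit-everywhere hit)
        where
        hit : ∀ i → i < n → Hit k (stage j) i
        hit i i<n with n <? k + i
        ... | yes n<k+i = hit-at (<⇒≤ i<n) n<k+i (subst (_∈ stage j) (sym at-n) (0∈stage j))
        ... | no  n≮k+i with i ≤? j * k
        ...   | yes i≤jk with m , k∣m , i≤m , m<k+i ← multiple-in-window k i =
                hit-at i≤m m<k+i (stage⁺ j (<-≤-trans m<k+i (≮⇒≥ n≮k+i))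
                  (inj₁ (multiple<[1+j]k⇒≤jk {j = j} k∣m (<-≤-trans m<k+i (+-monoʳ-≤ k i≤jk)) , k∣m)))
        ...   | no  i≰jk with t , t<k , t∈ ← cover⇒hit k≤n coverA i =
                t , t<k , stage⁺ j (<-≤-trans (+-monoˡ-< i t<k) (≮⇒≥ n≮k+i))
                  (inj₂ (<-≤-trans (≰⇒> i≰jk) (m≤n+m i t) , t∈))

      stage₀⊆ : stage 0 ⊆ A
      stage₀⊆ {x} x∈ with stage⁻ 0 x∈
      ... | inj₂ (_ , p)   = subst (_∈ A) (at-position x) p
      ... | inj₁ (≤0 , _) = subst (_∈ A) (trans (cong at (sym (n≤0⇒n≡0 ≤0))) (at-position x)) 0∈A

      stage-suc : ∀ {j x} → x ∈ stage (suc j) → x ∈ stage j ⊎ position x ≡ suc j * k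
      stage-suc {j} {x} x∈ with stage⁻ (suc j) x∈ | stage⁺ j (position<n x)
      ... | inj₂ (lt , p) | intro = inj₁ (subst (_∈ stage j) (at-position x)
              (intro (inj₂ (≤-<-trans (m≤n+m (j * k) k) lt , p))))
      ... | inj₁ (≤[1+j]k , k∣) | intro with m≤n⇒m<n∨m≡n ≤[1+j]k
      ...   | inj₂ eq = inj₂ eq
      ...   | inj₁ lt = inj₁ (subst (_∈ stage j) (at-position x)
                (intro (inj₁ (multiple<[1+j]k⇒≤jk {j = j} k∣ lt , k∣))))

      -- The token at (j + 1) k is added before the ones it makes redundant are removed.
      bridge : ℕ → Subset n
      bridge j = stage j [ at (suc j * k) ]≔ inside

      stage-suc⊆bridge : ∀ j → stage (suc j) ⊆ bridge j
      stage-suc⊆bridge j {x} x∈ with stage-suc {j} x∈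
      ... | inj₁ x∈j = ⊆-insert (stage j) (at (suc j * k)) x∈j
      ... | inj₂ eq  = subst (_∈ bridge j) (trans (cong at (sym eq)) (at-position x))
                         (∈-insert (stage j) (at (suc j * k)))

      -- The window from `j k + 1` to `(j + 1) k` contains a token of `stage j`. If `(j + 1) k` is
      -- at least `n`, or if that token is the one at `(j + 1) k`, nothing new is added. Otherwise
      -- the token lies strictly between two multiples and disappears, which pays for the new one.
      ∣stage-suc∣≤ : ∀ j → ∣ stage (suc j) ∣ ≤ ∣ stage j ∣
      ∣stage-suc∣≤ j with t , t<k , t∈ ← cover⇒hit k≤n (stage-cover j) (suc (j * k))
        with suc j * k <? n
      ... | no  ≮n = p⊆q⇒∣p∣≤∣q∣ λ {x} x∈ →
              [ id , (λ eq → contradiction (subst (_< n) eq (position<n x)) ≮n) ]′ (stage-suc {j} x∈)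
      ... | yes <n with m≤n⇒m<n∨m≡n (+-monoˡ-≤ (j * k) t<k)
      ...   | inj₂ eq = p⊆q⇒∣p∣≤∣q∣ λ {x} x∈ →
              [ id , (λ e → subst (_∈ stage j)
                  (trans (cong at (trans (+-suc t (j * k)) (trans eq (sym e)))) (at-position x)) t∈) ]′
                (stage-suc {j} x∈)
      ...   | inj₁ lt = ≤-pred (≤-trans (p⊂q⇒∣p∣<∣q∣ (stage-suc⊆bridge j , at p , p∈bridge , p∉))
                          (∣insert∣≤ (stage j) (at (suc j * k))))
        where
        p = t + suc (j * k)
        p< : p < suc j * k
        p< = subst (_< suc j * k) (sym (+-suc t (j * k))) lt
        p<n : p < n
        p<n = <-trans p< <n
        p∈bridge : at p ∈ bridge j
        p∈bridge = ⊆-insert (stage j) (at (suc j * k)) t∈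
        p∉ : at p ∉ stage (suc j)
        p∉ p∈ with subst (Stage (suc j)) (position-at p<n) (stage⁻ (suc j) p∈)
        ... | inj₁ (_ , k∣p) = <⇒≱ (m≤n+m (suc (j * k)) t) (multiple<[1+j]k⇒≤jk {j = j} k∣p p<)
        ... | inj₂ (lt , _)  = <-asym lt p<

      module _ (∣A∣≤v : ∣ A ∣ ≤ v) where

        ∣stage∣≤v : ∀ j → ∣ stage j ∣ ≤ v
        ∣stage∣≤v zero    = ≤-trans (p⊆q⇒∣p∣≤∣q∣ stage₀⊆) ∣A∣≤v
        ∣stage∣≤v (suc j) = ≤-trans (∣stage-suc∣≤ j) (∣stage∣≤v j)

        ~stage : ∀ j → A ~ stage j
        ~stage zero    = ⊇⇒~ stage₀⊆ (stage-cover 0) (m≤n⇒m≤1+n ∣A∣≤v)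
        ~stage (suc j) = ~stage j ◅◅ common-superset⇒~ (bridge j)
          (⊆-insert (stage j) (at (suc j * k))) (stage-suc⊆bridge j)
          (≤-trans (∣insert∣≤ (stage j) (at (suc j * k))) (s≤s (∣stage∣≤v j)))
          (stage-cover j) (stage-cover (suc j))

        stage-n≡multiples : stage n ≡ multiples
        stage-n≡multiples = ⊆-antisym
          (λ {x} x∈ → subst (_∈ multiples) (at-position x) (select⁺ (k ∣?_) (position<n x)
             ([ proj₂ , (λ (lt , _) → contradiction (late x) (<⇒≱ lt)) ]′ (stage⁻ n x∈))))
          (λ {x} x∈ → subst (_∈ stage n) (at-position x) (stage⁺ n (position<n x)
             (inj₁ (late x , select⁻ (k ∣?_) x∈))))
          where
          late : ∀ x → position x ≤ n * k
          late x = ≤-trans (<⇒≤ (position<n x)) (m≤m*n n k)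

        ~multiples : A ~ multiples
        ~multiples = subst (A ~_) stage-n≡multiples (~stage n)

        multiples-cover : Cover multiples
        multiples-cover = subst Cover stage-n≡multiples (stage-cover n)

        ∣multiples∣≤v : ∣ multiples ∣ ≤ v
        ∣multiples∣≤v = subst (λ B → ∣ B ∣ ≤ v) stage-n≡multiples (∣stage∣≤v n)

-- Double counting

-- It grows at the upper end, in step with the machine's counter, whereas `sum` splits off the lower
-- end.
tally : (ℕ → Bool) → ℕ → ℕ
tally b zero    = 0
tally b (suc m) = bit (b m) + tally b m

tally-cong : ∀ {b c} m → (∀ i → i < m → b i ≡ c i) → tally b m ≡ tally c m
tally-cong zero    _  = refl
tally-cong (suc m) eq =
  cong₂ _+_ (cong bit (eq m (n<1+n m))) (tally-cong m λ i i<m → eq i (<-trans i<m (n<1+n m)))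

tally-+ : ∀ b l m → tally b (l + m) ≡ tally b l + tally (b ∘ (l +_)) m
tally-+ b l zero    = trans (cong (tally b) (+-identityʳ l)) (sym (+-identityʳ _))
tally-+ b l (suc m) = begin
  tally b (l + suc m)                               ≡⟨ cong (tally b) (+-suc l m) ⟩
  bit (b (l + m)) + tally b (l + m)                 ≡⟨ cong (bit (b (l + m)) +_) (tally-+ b l m) ⟩
  bit (b (l + m)) + (tally b l + _)                 ≡⟨ +-assoc (bit (b (l + m))) (tally b l) _ ⟨
  bit (b (l + m)) + tally b l + _
    ≡⟨ cong (_+ tally (b ∘ (l +_)) m) (+-comm (bit (b (l + m))) (tally b l)) ⟩
  tally b l + bit (b (l + m)) + _                   ≡⟨ +-assoc (tally b l) (bit (b (l + m))) _ ⟩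
  tally b l + tally (b ∘ (l +_)) (suc m)            ∎
  where open ≡-Reasoning

tally-false : ∀ {b} m → (∀ i → i < m → b i ≡ false) → tally b m ≡ 0
tally-false zero    _  = refl
tally-false (suc m) eq rewrite eq m (n<1+n m) = tally-false m λ i i<m → eq i (<-trans i<m (n<1+n m))

tally≡sum : ∀ b m → tally b m ≡ sum {m} (bit ∘ b ∘ toℕ)
tally≡sum b zero    = refl
tally≡sum b (suc m) = trans (tally-+ b 1 m)
  (cong₂ _+_ (+-identityʳ (bit (b 0))) (tally≡sum (b ∘ suc) m))

tally-multiples : ∀ k .{{_ : NonZero k}} q → tally (λ i → does (k ∣? i)) (q * k) ≡ q
tally-multiples k       zero    = refl
tally-multiples k@(suc k-1) (suc q) = begin
  tally b (k + q * k)                          ≡⟨ tally-+ b k (q * k) ⟩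
  tally b k + tally (b ∘ (k +_)) (q * k)       ≡⟨ cong₂ _+_ first (tally-cong (q * k) λ i _ → period i) ⟩
  1 + tally b (q * k)                          ≡⟨ cong suc (tally-multiples k q) ⟩
  suc q                                        ∎
  where
  open ≡-Reasoning
  b : ℕ → Bool
  b i = does (k ∣? i)
  period : ∀ i → b (k + i) ≡ b i
  period i = does-⇔ (mk⇔ (λ d → ∣m+n∣m⇒∣n d ∣-refl) (∣m∣n⇒∣m+n ∣-refl)) (k ∣? (k + i)) (k ∣? i)
  first : tally b k ≡ 1
  first = trans (tally-+ b 1 k-1) (cong₂ _+_ (trans (+-identityʳ _) (cong bit (dec-true (k ∣? 0) (k ∣0))))
    (tally-false k-1 λ i i<k-1 → dec-false (k ∣? suc i) (>⇒∤ (s≤s i<k-1))))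

component≤sum : ∀ {n} (f : Fin n → ℕ) i → f i ≤ sum f
component≤sum f zero    = m≤m+n (f zero) _
component≤sum f (suc i) = ≤-trans (component≤sum (f ∘ suc) i) (m≤n+m _ (f zero))

two-components≤sum : ∀ {n} (f : Fin n → ℕ) {i j} → i ≢ j → f i + f j ≤ sum f
two-components≤sum f {zero}  {zero}  i≢j = contradiction refl i≢j
two-components≤sum f {zero}  {suc j} i≢j = +-monoʳ-≤ (f zero) (component≤sum (f ∘ suc) j)
two-components≤sum f {suc i} {zero}  i≢j =
  subst (_≤ sum f) (+-comm (f zero) _) (+-monoʳ-≤ (f zero) (component≤sum (f ∘ suc) i))
two-components≤sum f {suc i} {suc j} i≢j =
  ≤-trans (two-components≤sum (f ∘ suc) (i≢j ∘ cong suc)) (m≤n+m _ (f zero))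

sum-positive : ∀ {n} (f : Fin n → ℕ) → (∀ i → 1 ≤ f i) → n ≤ sum f
sum-positive {zero}  f 1≤f = z≤n
sum-positive {suc n} f 1≤f = +-mono-≤ (1≤f zero) (sum-positive (f ∘ suc) (1≤f ∘ suc))

sum-positive-tight : ∀ {n} (f : Fin n → ℕ) → (∀ i → 1 ≤ f i) → sum f ≤ n → ∀ i → f i ≤ 1
sum-positive-tight {suc n} f 1≤f ≤n zero = +-cancelʳ-≤ n (f zero) 1
  (≤-trans (+-monoʳ-≤ (f zero) (sum-positive (f ∘ suc) (1≤f ∘ suc))) ≤n)
sum-positive-tight {suc n} f 1≤f ≤n (suc i) = sum-positive-tight (f ∘ suc) (1≤f ∘ suc)
  (≤-pred (≤-trans (+-monoˡ-≤ _ (1≤f zero)) ≤n)) i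

sum-constant : ∀ n c → sum {n} (λ _ → c) ≡ n * c
sum-constant zero    c = refl
sum-constant (suc n) c = cong (c +_) (sum-constant n c)

∣∣≡sum : ∀ {n} (A : Subset n) → ∣ A ∣ ≡ sum (bit ∘ lookup A)
∣∣≡sum []          = refl
∣∣≡sum (true  ∷ A) = cong suc (∣∣≡sum A)
∣∣≡sum (false ∷ A) = ∣∣≡sum A

module Counting {n : ℕ} .{{_ : NonZero n}} {G : Graph n} (W : Winding G) where
  open Winding W
  open Positions W

  ∣∣≡sum-at : ∀ A → ∣ A ∣ ≡ sum {n} (λ i → bit (lookup A (at (toℕ i))))
  ∣∣≡sum-at A = trans (∣∣≡sum A) (sum-permute (bit ∘ lookup A) (permutation
    (at ∘ toℕ) (λ v → fromℕ< (position<n v))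
    (λ v → trans (cong at (Finₚ.toℕ-fromℕ< (position<n v))) (at-position v))
    (λ i → Finₚ.toℕ-injective
       (trans (Finₚ.toℕ-fromℕ< (position<n (at (toℕ i)))) (position-at (Finₚ.toℕ<n i))))))

  ∣∣≡tally : ∀ A → ∣ A ∣ ≡ tally (λ i → lookup A (at i)) n
  ∣∣≡tally A = trans (∣∣≡sum-at A) (sym (tally≡sum _ n))

module DoubleCounting {n : ℕ} .{{_ : NonZero n}} {G : Graph n} (W : Winding G)
                      (k : ℕ) {A : Subset n} where
  open Winding W
  open Positions W

  window : Fin n → ℕ
  window i = sum {k} λ j → bit (lookup A (at (toℕ j + toℕ i)))

  -- After exchanging the sums, each offset `j` counts all of `A` once, along the winding shifted by
  -- `j`.
  sum-window : sum window ≡ k * ∣ A ∣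
  sum-window = begin
    sum window
      ≡⟨ ∑-comm {n} {k} (λ i j → bit (lookup A (at (toℕ j + toℕ i)))) ⟩
    sum {k} (λ j → sum {n} λ i → bit (lookup A (at (toℕ j + toℕ i))))
      ≡⟨ sum-cong-≗ {k} (λ j → trans
           (sum-cong-≗ {n} λ i → cong (bit ∘ lookup A) (sym (at-shiftBy (toℕ j) W (toℕ i))))
           (sym (Counting.∣∣≡sum-at (shiftBy (toℕ j) W) A))) ⟩
    sum {k} (λ _ → ∣ A ∣)
      ≡⟨ sum-constant k ∣ A ∣ ⟩
    k * ∣ A ∣  ∎
    where open ≡-Reasoning

  module _ (hit : ∀ i → Hit k A i) where

    1≤window : ∀ i → 1 ≤ window i
    1≤window i with j , j<k , j∈ ← hit (toℕ i) = subst (_≤ window i)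
      (cong bit (trans (cong (λ m → lookup A (at (m + toℕ i))) (Finₚ.toℕ-fromℕ< j<k)) ([]=⇒lookup j∈)))
      (component≤sum _ (fromℕ< j<k))

    n≤k∣A∣ : n ≤ k * ∣ A ∣
    n≤k∣A∣ = subst (n ≤_) sum-window (sum-positive window 1≤window)

    -- Tightness leaves exactly one token in every window. The window from 1 to `k` has a token;
    -- anywhere but at `k` it would share the window from 0 to `k − 1` with the token at 0.
    tight⇒next : k * ∣ A ∣ ≤ n → at 0 ∈ A → at k ∈ A
    tight⇒next tight 0∈ with j , j<k , j∈ ← hit 1 with m≤n⇒m<n∨m≡n j<k
    ... | inj₂ eq = subst (λ m → at m ∈ A) (trans (+-comm j 1) eq) j∈
    ... | inj₁ lt = contradiction (≤-trans two (sum-positive-tight window 1≤window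
                      (subst (_≤ n) (sym sum-window) tight) z)) (<⇒≱ (n<1+n 1))
      where
      z = fromℕ< (>-nonZero⁻¹ n)
      a = fromℕ< (<-trans (s≤s z≤n) lt)
      b = fromℕ< lt
      toℕz : toℕ z ≡ 0
      toℕz = Finₚ.toℕ-fromℕ< (>-nonZero⁻¹ n)
      toℕa : toℕ a ≡ 0
      toℕa = Finₚ.toℕ-fromℕ< (<-trans (s≤s z≤n) lt)
      toℕb : toℕ b ≡ suc j
      toℕb = Finₚ.toℕ-fromℕ< lt
      member : ∀ {x m} → toℕ x ≡ m → at m ∈ A → bit (lookup A (at (toℕ x + toℕ z))) ≡ 1
      member {x} {m} eq m∈ = cong bit (trans
        (cong₂ (λ p q → lookup A (at (p + q))) eq toℕz)
        (trans (cong (lookup A ∘ at) (+-identityʳ m)) ([]=⇒lookup m∈)))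
      two : 2 ≤ window z
      two = subst (_≤ window z) (cong₂ _+_ (member toℕa 0∈)
              (member toℕb (subst (λ m → at m ∈ A) (+-comm j 1) j∈)))
              (two-components≤sum (λ x → bit (lookup A (at (toℕ x + toℕ z)))) {a} {b}
                λ a≡b → 0≢1+n (trans (sym toℕa) (trans (cong toℕ a≡b) toℕb)))

-- Rotating swept covers, and redundant tokens

least : ∀ {P : ℕ → Set} → (∀ i → Dec (P i)) → ∀ m → P m →
        ∃[ i ] i ≤ m × P i × (∀ j → j < i → ¬ P j)
least P? m p with P? 0
... | yes p₀ = 0 , z≤n , p₀ , λ _ ()
least P? zero    p | no ¬p₀ = contradiction p ¬p₀
least P? (suc m) p | no ¬p₀ with i , i≤m , pᵢ , min ← least (P? ∘ suc) m p =
  suc i , s≤s i≤m , pᵢ , λ { zero _ → ¬p₀ ; (suc j) (s≤s j<i) → min j j<i }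

module Rotation {n : ℕ} .{{_ : NonZero n}} {G : Graph n}
                {k : ℕ} (2≤k : 2 ≤ k) (k≤n : k ≤ n) (v : ℕ) where

  open Connectivity {G = G} 2≤k k≤n v public

  private instance
    k≢0 : NonZero k
    k≢0 = >-nonZero (≤-trans (s≤s z≤n) 2≤k)

  module _ (W : Winding G) where
    open Winding W
    open Positions W
    open Multiples W

    ∣multiples∣*k≡n : k ∣ n → ∣ multiples ∣ * k ≡ n
    ∣multiples∣*k≡n (divides q n≡qk) = trans (cong (_* k) (begin
      ∣ multiples ∣                                ≡⟨ Counting.∣∣≡tally W multiples ⟩
      tally (λ i → lookup multiples (at i)) n      ≡⟨ tally-cong n (λ i i<n → trans
          (lookup∘tabulate _ (at i)) (cong (does ∘ (k ∣?_)) (position-at i<n))) ⟩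
      tally (λ i → does (k ∣? i)) n                ≡⟨ cong (tally _) n≡qk ⟩
      tally (λ i → does (k ∣? i)) (q * k)          ≡⟨ tally-multiples k q ⟩
      q                                            ∎)) (sym n≡qk)
      where open ≡-Reasoning

    Reaches1 : Set
    Reaches1 = ∃[ B ] Cover B × ∣ B ∣ ≤ v × at 1 ∈ B × multiples ~ B

    module _ (cover : Cover multiples) (size : ∣ multiples ∣ ≤ v) where

      private
        inserted : Subset n
        inserted = multiples [ at 1 ]≔ inside

        ⊆inserted : multiples ⊆ inserted
        ⊆inserted = ⊆-insert multiples (at 1)

      -- Here the multiples number `n / k`, which is less than `v`, so one more token fits without
      -- exceeding `v`.
      reaches1-if-divides : k ∣ n → n < v * k → Reaches1
      reaches1-if-divides k∣n n<vk =
        inserted , cover-⊆ ⊆inserted cover , small , ∈-insert multiples (at 1) ,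
        common-superset⇒~ inserted ⊆inserted id (m≤n⇒m≤1+n small) cover (cover-⊆ ⊆inserted cover)
        where
        small : ∣ inserted ∣ ≤ v
        small = ≤-trans (∣insert∣≤ multiples (at 1))
          (*-cancelʳ-< k ∣ multiples ∣ v (subst (_< v * k) (sym (∣multiples∣*k≡n k∣n)) n<vk))

      -- Take a multiple `m` of `k` in a given window. It is not `n`. If it is beyond `n`, the
      -- window also contains `n + 1`, where the slid token sits. If it is strictly between 0 and
      -- `n`, it was not moved. If it is 0, the window starts there and contains position 1 because
      -- `2 ≤ k`.
      reaches1-unless-divides : ¬ k ∣ n → Reaches1
      reaches1-unless-divides k∤n =
        slid , slid-cover , ≤-trans ∣slid∣≤ size , 1∈slid ,
        common-superset⇒~ inserted ⊆inserted (delete-⊆ inserted (at 0))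
          (≤-trans (∣insert∣≤ multiples (at 1)) (s≤s size)) cover slid-cover
        where
        slid : Subset n
        slid = inserted [ at 0 ]≔ outside
        1<n : 1 < n
        1<n = <-≤-trans 2≤k k≤n
        0∈multiples : at 0 ∈ multiples
        0∈multiples = select⁺ (k ∣?_) (<-trans (s≤s z≤n) 1<n) (k ∣0)
        1∈slid : at 1 ∈ slid
        1∈slid = ∈-delete inserted (at 0) (∈-insert multiples (at 1))
          (≢-sym (apart (s≤s z≤n) (≤-trans 1<n (m≤m+n n 0))))
        multiple∈slid : ∀ {m} → k ∣ m → 0 < m → m < n → at m ∈ slid
        multiple∈slid k∣m 0<m m<n = ∈-delete inserted (at 0) (⊆inserted (select⁺ (k ∣?_) m<n k∣m))
          (≢-sym (apart 0<m (m≤n⇒m≤n+o 0 m<n)))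
        ∣slid∣≤ : ∣ slid ∣ ≤ ∣ multiples ∣
        ∣slid∣≤ = ≤-pred (≤-trans
          (p⊂q⇒∣p∣<∣q∣ (delete-⊆ inserted (at 0) , at 0 , ⊆inserted 0∈multiples , ∉-delete inserted (at 0)))
          (∣insert∣≤ multiples (at 1)))
        slid-cover : Cover slid
        slid-cover = hit⇒cover 2≤k (hit-everywhere hit)
          where
          hit : ∀ i → i < n → Hit k slid i
          hit i i<n with m , k∣m , i≤m , m<k+i ← multiple-in-window k i with <-cmp m n
          ... | tri≈ _ refl _ = contradiction k∣m k∤n
          ... | tri> _ _ n<m  = hit-at (≤-trans (<⇒≤ i<n) (n≤1+n n)) (≤-<-trans n<m m<k+i)
                                  (subst (_∈ slid) (sym at-1+n) 1∈slid)
          ... | tri< m<n _ _ with m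
          ...   | suc _ = hit-at i≤m m<k+i (multiple∈slid k∣m (s≤s z≤n) m<n)
          ...   | zero  with refl ← n≤0⇒n≡0 i≤m =
                  hit-at z≤n (<-≤-trans 2≤k (m≤m+n k 0)) 1∈slid

      reaches1 : n < v * k → Reaches1
      reaches1 n<vk with k ∣? n
      ... | yes k∣n = reaches1-if-divides k∣n n<vk
      ... | no  k∤n = reaches1-unless-divides k∤n

  module _ (n<vk : n < v * k) (W : Winding G) where
    open Winding W

    -- Each round moves the starting point by one: obtain a cover with a token at the next position,
    -- then sweep afresh from that token.
    spin : ∀ {A} s → Cover A → ∣ A ∣ ≤ v → at s ∈ A → ∀ d →
           let open Multiples (shiftBy d (shiftBy s W)) in
           A ~ multiples × Cover multiples × ∣ multiples ∣ ≤ v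
    spin {A} s cover size s∈ zero = ~multiples size , multiples-cover size , ∣multiples∣≤v size
      where
      open Multiples (shiftBy s W)
      open Sweep cover (subst (_∈ A) (sym (trans (at-shiftBy s W 0) (cong at (+-identityʳ s)))) s∈)
    spin {A} s cover size s∈ (suc d)
      with ~m , cover-m , size-m ← spin s cover size s∈ d
      with B , cover-B , size-B , 1∈B , m~B ← reaches1 (shiftBy d (shiftBy s W)) cover-m size-m n<vk =
      ~m ◅◅ m~B ◅◅ ~multiples size-B , multiples-cover size-B , ∣multiples∣≤v size-B
      where
      W′ = shiftBy d (shiftBy s W)
      open Multiples (shift W′)
      open Sweep cover-B (subst (_∈ B) (sym (at-shift W′ 0)) 1∈B)

    shiftBy-comm : ∀ d s → shiftBy d (shiftBy s W) ≡ shiftBy s (shiftBy d W)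
    shiftBy-comm d s = trans (sym (shiftBy-+ d s))
      (trans (cong (λ m → shiftBy m W) (+-comm d s)) (shiftBy-+ s d))
      where
      shiftBy-+ : ∀ d s → shiftBy (d + s) W ≡ shiftBy d (shiftBy s W)
      shiftBy-+ zero    s = refl
      shiftBy-+ (suc d) s = cong shift (shiftBy-+ d s)

    -- With tokens of `A` and `B` at positions `a` and `b`, the first is rotated `b` further and the
    -- second `a` further. Both arrive at the multiples started from `a + b`, without comparing `a`
    -- and `b`.
    ample⇒~ : ∀ {A B} → Cover A → ∣ A ∣ ≤ v → Cover B → ∣ B ∣ ≤ v → A ~ B
    ample⇒~ {A} {B} cover-A size-A cover-B size-B
      with a , _ , a∈ ← Positions.cover⇒hit W k≤n cover-A 0
      with b , _ , b∈ ← Positions.cover⇒hit W k≤n cover-B 0 =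
      subst (λ W → A ~ Multiples.multiples W) (shiftBy-comm (b + 0) (a + 0))
        (proj₁ (spin (a + 0) cover-A size-A a∈ (b + 0)))
      ◅◅ ~-sym (proj₁ (spin (b + 0) cover-B size-B b∈ (a + 0)))

  -- The union has at most `v + v ≤ 1 + v` tokens.
  few⇒~ : ∀ {A B} → v ≤ 1 → Cover A → ∣ A ∣ ≤ v → Cover B → ∣ B ∣ ≤ v → A ~ B
  few⇒~ {A} {B} v≤1 cover-A size-A cover-B size-B =
    common-superset⇒~ (A ∪ B) (p⊆p∪q B) (q⊆p∪q A B)
      (≤-trans (∣p∪q∣≤∣p∣+∣q∣ A B) (≤-trans (+-mono-≤ size-A size-B) (+-monoˡ-≤ v v≤1)))
      cover-A cover-B

  module _ (W : Winding G) where
    open Winding W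
    open Positions W
    open Multiples W using (hit-at)

    -- Three tokens within k + 1 consecutive vertices, the middle one being redundant.
    Crowded : Subset n → Set
    Crowded A = ∃[ p ] ∃[ q ] ∃[ l ] p < q × q < l × l ≤ k + p × at p ∈ A × at q ∈ A × at l ∈ A

    SmallerCover : Subset n → Set
    SmallerCover A = ∃[ B ] B ⊆ A × Cover B × ∣ B ∣ < ∣ A ∣

    -- Suppose a window contains `q` at offset `j`. If `j` is at least `q − p`, it also contains
    -- `p`; otherwise `l` has offset `(l − q) + j`, which is less than `l − p ≤ k`. The windows may
    -- lie in another turn than the triple, so positions are carried over by `at-cancel` and
    -- `at-cong`.
    crowded⇒smaller : ∀ {A} → Cover A → Crowded A → SmallerCover A
    crowded⇒smaller {A} cover (p , q , l , p<q , q<l , l≤k+p , p∈ , q∈ , l∈) =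
      B , delete-⊆ A (at q) , hit⇒cover 2≤k hit ,
      p⊂q⇒∣p∣<∣q∣ (delete-⊆ A (at q) , at q , q∈ , ∉-delete A (at q))
      where
      B = A [ at q ]≔ outside
      p∈B : at p ∈ B
      p∈B = ∈-delete A (at q) p∈ (apart p<q
        (<-≤-trans q<l (≤-trans l≤k+p (+-monoˡ-≤ p k≤n))))
      l∈B : at l ∈ B
      l∈B = ∈-delete A (at q) l∈ (≢-sym (apart q<l
        (<-≤-trans (s≤s l≤k+p) (≤-trans (≤-reflexive (sym (+-suc k p))) (+-mono-≤ k≤n p<q)))))
      hit : ∀ i → Hit k B i
      hit i with j , j<k , j∈ ← cover⇒hit k≤n cover i with at (j + i) Finₚ.≟ at q
      ... | no  ≢q = j , j<k , ∈-delete A (at q) j∈ ≢q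
      ... | yes ≡q with q ∸ p ≤? j
      ...   | yes q-p≤j = j ∸ (q ∸ p) , ≤-<-trans (m∸n≤m j (q ∸ p)) j<k ,
              subst (_∈ B) (sym (at-cancel (q ∸ p) (trans (cong at (trans
                (sym (+-assoc (q ∸ p) (j ∸ (q ∸ p)) i)) (cong (_+ i) (m+[n∸m]≡n q-p≤j))))
                (trans ≡q (cong at (sym (m∸n+n≡m (<⇒≤ p<q)))))))) p∈B
      ...   | no  q-p≰j = (l ∸ q) + j , inside-window ,
              subst (_∈ B) (sym (trans (cong at (+-assoc (l ∸ q) j i))
                (trans (at-cong (l ∸ q) ≡q) (cong at (m∸n+n≡m (<⇒≤ q<l)))))) l∈B
        where
        inside-window : (l ∸ q) + j < k
        inside-window = +-cancelʳ-< p _ k (<-≤-trans (begin-strict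
          l ∸ q + j + p        <⟨ +-monoˡ-< p (+-monoʳ-< (l ∸ q) (≰⇒> q-p≰j)) ⟩
          l ∸ q + (q ∸ p) + p  ≡⟨ +-assoc (l ∸ q) (q ∸ p) p ⟩
          l ∸ q + (q ∸ p + p)  ≡⟨ cong (l ∸ q +_) (m∸n+n≡m (<⇒≤ p<q)) ⟩
          l ∸ q + q            ≡⟨ m∸n+n≡m (<⇒≤ q<l) ⟩
          l                    ∎) l≤k+p)
          where open ≤-Reasoning

    -- Let `q` be a position of a token in `A` but not in `B`, and `l` the first position after `q`
    -- with a token of `B`. The `k` positions just before `l` contain a token of `B`; it is not at
    -- `q`, and by the choice of `l` not between `q` and `l`, so it comes before `q`.
    smaller⇒crowded : ∀ {A B} → Cover B → B ⊆ A → ∣ B ∣ < ∣ A ∣ → Crowded A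
    smaller⇒crowded {A} {B} cover B⊆A size
      with Finₚ.any? (λ x → (x ∈? A) ×-dec (¬? (x ∈? B)))
    ... | no  none = contradiction (p⊆q⇒∣p∣≤∣q∣ {p = A} {B} A⊆B) (<⇒≱ size)
      where
      A⊆B : A ⊆ B
      A⊆B {x} x∈A with x ∈? B
      ... | yes x∈B = x∈B
      ... | no  x∉B = contradiction (x , x∈A , x∉B) none
    ... | yes (x , x∈A , x∉B)
      -- The margin of `k` keeps the window that ends just before `l` at nonnegative positions.
      with i , _ , at-q ← onto-from k x
      with t , t<k , t∈ ← cover⇒hit k≤n cover (suc (k + i))
      with s , s≤t , s∈ , min ← least (λ t → at (t + suc (k + i)) ∈? B) t t∈
      with r , r<k , r∈ ← cover⇒hit k≤n cover (s + suc i) =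
      r + (s + suc i) , k + i , s + suc (k + i) , p<q , m≤n+m (suc (k + i)) s , close ,
      B⊆A r∈ , subst (_∈ A) (sym at-q) x∈A , B⊆A s∈
      where
      shuffle : s + suc (k + i) ≡ k + (s + suc i)
      shuffle = trans (cong (s +_) (sym (+-suc k i)))
        (trans (sym (+-assoc s k (suc i))) (trans (cong (_+ suc i) (+-comm s k)) (+-assoc k s (suc i))))
      close : s + suc (k + i) ≤ k + (r + (s + suc i))
      close = subst (_≤ k + (r + (s + suc i))) (sym shuffle) (+-monoʳ-≤ k (m≤n+m (s + suc i) r))
      p<l : r + (s + suc i) < s + suc (k + i)
      p<l = subst (r + (s + suc i) <_) (sym shuffle) (+-monoˡ-< (s + suc i) r<k)
      p<q : r + (s + suc i) < k + i
      p<q with <-cmp (r + (s + suc i)) (k + i)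
      ... | tri< lt _ _ = lt
      ... | tri≈ _ eq _ = contradiction (subst (_∈ B) (trans (cong at eq) at-q) r∈) x∉B
      ... | tri> _ _ gt = contradiction
              (subst (λ m → at m ∈ B) (sym (m∸n+n≡m gt)) r∈)
              (min (r + (s + suc i) ∸ suc (k + i))
                 (+-cancelʳ-< (suc (k + i)) _ s (subst (_< s + suc (k + i)) (sym (m∸n+n≡m gt)) p<l)))

-- Exactly when two covers are linked

module Characterisation {n : ℕ} .{{_ : NonZero n}} {G : Graph n}
                        {k : ℕ} (2≤k : 2 ≤ k) (k≤n : k ≤ n) (v : ℕ) (W : Winding G) where

  open Rotation {G = G} 2≤k k≤n v public hiding (Crowded)
  open Winding W
  open Positions W

  private instance
    k≢0 : NonZero k
    k≢0 = >-nonZero (≤-trans (s≤s z≤n) 2≤k)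

  Crowded : Subset n → Set
  Crowded = Rotation.Crowded {G = G} 2≤k k≤n v W

  Free : Subset n → Set
  Free A = ∣ A ∣ ≤ v ⊎ Crowded A

  Roomy : Set
  Roomy = v ≤ 1 ⊎ n < v * k

  free⇒small : ∀ {A} → Cover A → ∣ A ∣ ≤ suc v → Free A → ∃[ B ] Cover B × ∣ B ∣ ≤ v × A ~ B
  free⇒small {A} cover _    (inj₁ ≤v) = A , cover , ≤v , ε
  free⇒small {A} cover size (inj₂ crowded)
    with B , B⊆A , cover-B , B<A ← crowded⇒smaller W cover crowded =
    B , cover-B , ≤-pred (≤-trans B<A size) , ⊇⇒~ B⊆A cover-B size

  free⇒~ : ∀ {A B} → Valid A → Valid B → Free A → Free B → Roomy → A ~ B
  free⇒~ (cover-A , size-A) (cover-B , size-B) free-A free-B roomy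
    with A′ , cover-A′ , size-A′ , A~A′ ← free⇒small cover-A size-A free-A
    with B′ , cover-B′ , size-B′ , B~B′ ← free⇒small cover-B size-B free-B =
    A~A′ ◅◅ [ (λ v≤1 → few⇒~ v≤1 cover-A′ size-A′ cover-B′ size-B′)
            , (λ n<vk → ample⇒~ n<vk W cover-A′ size-A′ cover-B′ size-B′) ]′ roomy ◅◅ ~-sym B~B′

  -- The sequence is not empty, since otherwise `A ∩ B` would be the cover `A`. Its first step
  -- decides: an addition shows that `A` is below the bound, a removal that `A` has a redundant
  -- token.
  ~⇒free : ∀ {A B} → ¬ Cover (A ∩ B) → Cover A → A ~ B → Free A
  ~⇒free {A} ¬cover cover ε = contradiction (subst Cover (sym (∩-idem A)) cover) ¬cover
  ~⇒free {A} ¬cover cover (_◅_ {j = Y} (_ , (cover-Y , size-Y) , e) _) with ∣pΔq∣≡1⇒nested A Y e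
  ... | inj₁ (_ , eq)   = inj₁ (≤-pred (subst (_≤ suc v) eq size-Y))
  ... | inj₂ (Y⊆A , eq) = inj₂ (smaller⇒crowded W cover-Y Y⊆A (≤-reflexive (sym eq)))

  -- When n ≥ v k, a cover with v tokens has one in every k consecutive vertices,
  -- hence is invariant under rotation by k; two different ones have at least v + 2 tokens together.
  module Tight (2≤v : 2 ≤ v) (vk≤n : v * k ≤ n) where

    next : ∀ {A} → Cover A → ∣ A ∣ ≤ v → ∀ s → at s ∈ A → at (k + s) ∈ A
    next {A} cover size s s∈ = subst (_∈ A) (at-s k)
      (DoubleCounting.tight⇒next (shiftBy s W) k (Positions.cover⇒hit (shiftBy s W) k≤n cover)
        (≤-trans (*-monoʳ-≤ k size) (subst (_≤ n) (*-comm v k) vk≤n))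
        (subst (_∈ A) (sym (trans (at-shiftBy s W 0) (cong at (+-identityʳ s)))) s∈))
      where
      at-s : ∀ i → Winding.at (shiftBy s W) i ≡ at (i + s)
      at-s i = trans (at-shiftBy s W i) (cong at (+-comm s i))

    next* : ∀ {A} → Cover A → ∣ A ∣ ≤ v → ∀ m s → at s ∈ A → at (m * k + s) ∈ A
    next* cover size zero    s s∈ = s∈
    next* {A} cover size (suc m) s s∈ = subst (λ i → at i ∈ A) (sym (+-assoc k (m * k) s))
      (next cover size (m * k + s) (next* cover size m s s∈))

    -- Going on by `k` another `n − 1` times adds up to `n k` positions, which are `k` full turns.
    previous : ∀ {A} → Cover A → ∣ A ∣ ≤ v → ∀ s → at (k + s) ∈ A → at s ∈ A
    previous {A} cover size s s∈ = subst (_∈ A)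
      (trans (cong at (begin
        pred n * k + (k + s)  ≡⟨ +-assoc (pred n * k) k s ⟨
        pred n * k + k + s    ≡⟨ cong (_+ s) (+-comm (pred n * k) k) ⟩
        suc (pred n) * k + s  ≡⟨ cong (λ m → m * k + s) (suc-pred n) ⟩
        n * k + s             ≡⟨ cong (_+ s) (*-comm n k) ⟩
        k * n + s             ∎)) (at-periodic k s))
      (next* cover size (pred n) (k + s) s∈)
      where open ≡-Reasoning

    v≤∣∣ : ∀ {A} → Cover A → v ≤ ∣ A ∣
    v≤∣∣ {A} cover = *-cancelˡ-≤ k (subst (_≤ k * ∣ A ∣) (*-comm v k)
      (≤-trans vk≤n (DoubleCounting.n≤k∣A∣ W k (cover⇒hit k≤n cover))))

    k<n : k < n
    k<n = <-≤-trans (m<m*n k v 2≤v) (subst (_≤ n) (*-comm v k) vk≤n)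

    -- If a token at `i` is in `A` but not in `B`, the invariance of both covers makes the same true
    -- at `k + i`, and `k < n` keeps the two places apart. So `C` would contain `B` and two further
    -- tokens.
    unique : ∀ {A B C} → Cover A → ∣ A ∣ ≤ v → Cover B → ∣ B ∣ ≤ v →
             A ⊆ C → B ⊆ C → ∣ C ∣ ≤ suc v → A ⊆ B
    unique {A} {B} {C} cover-A size-A cover-B size-B A⊆C B⊆C size-C {x} x∈A with x ∈? B
    ... | yes x∈B = x∈B
    ... | no  x∉B with i , _ , refl ← onto x = contradiction
        (≤-trans (s≤s (s≤s (v≤∣∣ cover-B)))
          (≤-trans (s≤s (p⊂q⇒∣p∣<∣q∣ (⊆-insert B (at i) , at i , ∈-insert B (at i) , x∉B)))
            (≤-trans (p⊂q⇒∣p∣<∣q∣ (plus-one⊆C , at (k + i) , A⊆C k+i∈A , k+i∉)) size-C)))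
        (<⇒≱ (n<1+n (suc v)))
      where
      k+i∈A : at (k + i) ∈ A
      k+i∈A = next cover-A size-A i x∈A
      k+i∉ : at (k + i) ∉ B [ at i ]≔ inside
      k+i∉ k+i∈ = x∉B (previous cover-B size-B i (∈-insert⁻ B (at i) k+i∈
        (≢-sym (apart (m<n+m i (>-nonZero⁻¹ k)) (+-monoˡ-< i k<n)))))
      plus-one⊆C : B [ at i ]≔ inside ⊆ C
      plus-one⊆C {y} y∈ with y Finₚ.≟ at i
      ... | yes refl = A⊆C x∈A
      ... | no  y≢   = B⊆C (∈-insert⁻ B (at i) y∈ y≢)

    -- Additions are harmless. A removal leads to a cover `Z` with at most `v` tokens inside `X`,
    -- which also contains `A`; by `unique` the tokens of `A` all survive in `Z`.
    retained : ∀ {A X Y} → Cover A → ∣ A ∣ ≤ v → A ⊆ X → X ~ Y → A ⊆ Y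
    retained cover size A⊆X ε = A⊆X
    retained {A} {X} cover size A⊆X (_◅_ {j = Z} ((_ , size-X) , (cover-Z , _) , e) rest)
      with ∣pΔq∣≡1⇒nested X Z e
    ... | inj₁ (X⊆Z , _)  = retained cover size (λ a → X⊆Z (A⊆X a)) rest
    ... | inj₂ (Z⊆X , eq) = retained cover size
            (unique cover size cover-Z (≤-pred (subst (_≤ suc v) eq size-X)) A⊆X Z⊆X size-X) rest

    -- Whichever way the first step goes, the smaller of the two sets involved is a cover with at
    -- most `v` tokens; it lies in `A` and is retained up to `B`.
    ~⇒common : ∀ {A B} → Cover A → A ~ B → Cover (A ∩ B)
    ~⇒common {A} cover ε = subst Cover (sym (∩-idem A)) cover
    ~⇒common {A} {B} cover (_◅_ {j = Y} (_ , (cover-Y , size-Y) , e) rest) with ∣pΔq∣≡1⇒nested A Y e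
    ... | inj₁ (A⊆Y , eq) = cover-⊆ (λ a → x∈p∩q⁺ (a ,
            retained cover (≤-pred (subst (_≤ suc v) eq size-Y)) A⊆Y rest a)) cover
    ~⇒common {A} {B} cover (_◅_ {j = Y} ((_ , size-A) , (cover-Y , _) , e) rest)
        | inj₂ (Y⊆A , eq) = cover-⊆ (λ y → x∈p∩q⁺ (Y⊆A y ,
            retained cover-Y (≤-pred (subst (_≤ suc v) eq size-A)) id rest y)) cover-Y

  ~⇒roomy : ∀ {A B} → ¬ Cover (A ∩ B) → Cover A → A ~ B → Roomy
  ~⇒roomy ¬cover cover A~B with 2 ≤? v | n <? v * k
  ... | no  2≰v | _        = inj₁ (≤-pred (≰⇒> 2≰v))
  ... | yes _   | yes n<vk = inj₂ n<vk
  ... | yes 2≤v | no  n≮vk = contradiction (Tight.~⇒common 2≤v (≮⇒≥ n≮vk) cover A~B) ¬cover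

sequence-bounds : ∀ {n k u} {G : Graph n} {A B} → TARSequence k G u A B → ∣ A ∣ ≤ u × ∣ B ∣ ≤ u
sequence-bounds S = subst (λ X → ∣ X ∣ ≤ _) start (bound zero) , subst (λ X → ∣ X ∣ ≤ _) end (bound _)
  where open TARSequence S

short⇒cover : ∀ {n k} {G : Graph n} {A} → n < k → IsPathVertexCover k G A
short⇒cover n<k P = contradiction (Finₚ.injective⇒≤ (injective P)) (<⇒≱ n<k)

-- Counters maintained while walking

module Counters (k : ℕ) where

  module _ (b : ℕ → Bool) where

    -- `life i` is how many more positions a token seen before position i stays within
    -- distance k, for the latest such token; `life₂ i` is the same for the latest but one.
    life life₂ : ℕ → ℕ
    life zero     = 0
    life (suc i)  = if b i then k else life i ∸ 1
    life₂ zero    = 0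
    life₂ (suc i) = if b i then life i ∸ 1 else life₂ i ∸ 1

  mark : ℕ → ℕ → ℕ
  mark zero    f = f
  mark (suc _) f = 1

  -- `life₂` is read before position `i` is recorded: if it is positive at a token, the latest but
  -- one of the earlier tokens is within distance `k`, and `i` completes a crowded triple.
  crowdFlag : (ℕ → Bool) → ℕ → ℕ
  crowdFlag b zero    = 0
  crowdFlag b (suc i) = if b i then mark (life₂ b i) (crowdFlag b i) else crowdFlag b i

  module _ {b : ℕ → Bool} where

    private
      age : ∀ m i → m + i ≤ m ∸ 1 + suc i
      age zero    i = n≤1+n i
      age (suc m) i = ≤-reflexive (sym (+-suc m i))

    -- A token at `p` sets `life b i + i` to `k + p + 1`. The sum stays there while the counter
    -- falls, and grows once truncated subtraction holds the counter at 0; hence the upper bound for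
    -- a positive counter here, and the unconditional lower bound in `life-complete`.
    life-sound : ∀ i → 0 < life b i → ∃[ p ] p < i × b p ≡ true × life b i + i ≤ suc (k + p)
    life-sound (suc i) lt with b i in eq
    ... | true  = i , n<1+n i , eq , ≤-reflexive (+-suc k i)
    ... | false with life b i | life-sound i
    ...   | suc (suc m) | ih with p , p<i , bp , le ← ih (s≤s z≤n) =
            p , <-trans p<i (n<1+n i) , bp , ≤-trans (≤-reflexive (+-suc (suc m) i)) le

    life-complete : ∀ {p i} → p < i → b p ≡ true → suc (k + p) ≤ life b i + i
    life-complete {p} {suc i} (s≤s p≤i) bp with b i in eq
    ... | true  = ≤-trans (s≤s (+-monoʳ-≤ k p≤i)) (≤-reflexive (sym (+-suc k i)))
    ... | false with m≤n⇒m<n∨m≡n p≤i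
    ...   | inj₁ p<i  = ≤-trans (life-complete p<i bp) (age (life b i) i)
    ...   | inj₂ refl with () ← trans (sym bp) eq

    life₂-sound : ∀ i → 0 < life₂ b i →
                  ∃[ p ] ∃[ q ] p < q × q < i × b p ≡ true × b q ≡ true × life₂ b i + i ≤ suc (k + p)
    life₂-sound (suc i) lt with b i in eq
    life₂-sound (suc i) lt | true with life b i | life-sound i
    ... | suc (suc m) | sound with p , p<i , bp , le ← sound (s≤s z≤n) =
          p , i , p<i , n<1+n i , bp , eq , ≤-trans (≤-reflexive (+-suc (suc m) i)) le
    life₂-sound (suc i) lt | false with life₂ b i | life₂-sound i
    ... | suc (suc m) | ih with p , q , p<q , q<i , bp , bq , le ← ih (s≤s z≤n) =
          p , q , p<q , <-trans q<i (n<1+n i) , bp , bq , ≤-trans (≤-reflexive (+-suc (suc m) i)) le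

    life₂-complete : ∀ {p q i} → p < q → q < i → b p ≡ true → b q ≡ true →
                     suc (k + p) ≤ life₂ b i + i
    life₂-complete {p} {q} {suc i} p<q (s≤s q≤i) bp bq with b i in eq
    ... | true  = ≤-trans (life-complete (<-≤-trans p<q q≤i) bp) (age (life b i) i)
    ... | false with m≤n⇒m<n∨m≡n q≤i
    ...   | inj₁ q<i  = ≤-trans (life₂-complete p<q q<i bp bq) (age (life₂ b i) i)
    ...   | inj₂ refl with () ← trans (sym bq) eq

    CrowdedBelow : ℕ → Set
    CrowdedBelow N = ∃[ p ] ∃[ q ] ∃[ l ] p < q × q < l × l ≤ k + p × l < N ×
                     b p ≡ true × b q ≡ true × b l ≡ true

    crowdFlag-sound : ∀ i → crowdFlag b i ≢ 0 → CrowdedBelow i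
    crowdFlag-sound zero    ≢0 = contradiction refl ≢0
    crowdFlag-sound (suc i) ≢0 with b i in eq
    crowdFlag-sound (suc i) ≢0 | true with life₂ b i | life₂-sound i
    ... | suc m | sound with p , q , p<q , q<i , bp , bq , le ← sound (s≤s z≤n) =
          p , q , i , p<q , q<i , ≤-trans (m≤n+m i m) (≤-pred le) , n<1+n i , bp , bq , eq
    ... | zero  | _ with p , q , l , p<q , q<l , le , l<i , rest ← crowdFlag-sound i ≢0 =
          p , q , l , p<q , q<l , le , <-trans l<i (n<1+n i) , rest
    crowdFlag-sound (suc i) ≢0 | false
      with p , q , l , p<q , q<l , le , l<i , rest ← crowdFlag-sound i ≢0 =
      p , q , l , p<q , q<l , le , <-trans l<i (n<1+n i) , rest

    mark≢0 : ∀ m {f} → f ≢ 0 → mark m f ≢ 0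
    mark≢0 zero    f≢0 = f≢0
    mark≢0 (suc m) _   ()

    crowdFlag-complete : ∀ i → CrowdedBelow i → crowdFlag b i ≢ 0
    crowdFlag-complete (suc i) (p , q , l , p<q , q<l , le , s≤s l≤i , bp , bq , bl) with m≤n⇒m<n∨m≡n l≤i
    ... | inj₁ l<i with b i | crowdFlag-complete i (p , q , l , p<q , q<l , le , l<i , bp , bq , bl)
    ...   | true  | ≢0 = mark≢0 (life₂ b i) ≢0
    ...   | false | ≢0 = ≢0
    crowdFlag-complete (suc i) (p , q , l , p<q , q<l , le , s≤s l≤i , bp , bq , bl) | inj₂ refl
      rewrite bl with life₂ b i | life₂-complete p<q q<l bp bq
    ...   | zero  | complete = contradiction (≤-trans complete le) (<⇒≱ (n<1+n (k + p)))
    ...   | suc m | _        = λ ()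

  -- `fuel c` runs out at the end of the first k consecutive positions without a token, for good.
  burn : Bool → ℕ → ℕ
  burn c     zero    = 0
  burn true  (suc e) = k
  burn false (suc e) = e

  fuel : (ℕ → Bool) → ℕ → ℕ
  fuel c zero    = k
  fuel c (suc i) = burn (c i) (fuel c i)

  module _ {c : ℕ → Bool} where

    burn≤k : ∀ x {e} → e ≤ k → burn x e ≤ k
    burn≤k x     {zero}  _   = z≤n
    burn≤k true  {suc e} _   = ≤-refl
    burn≤k false {suc e} e<k = <⇒≤ e<k

    fuel≤k : ∀ i → fuel c i ≤ k
    fuel≤k zero    = ≤-refl
    fuel≤k (suc i) = burn≤k (c i) (fuel≤k i)

    burn-zero : ∀ x {e} → e ≡ 0 → burn x e ≡ 0
    burn-zero true  refl = refl
    burn-zero false refl = refl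

    fuel-spent : ∀ m {i} → fuel c i ≡ 0 → fuel c (m + i) ≡ 0
    fuel-spent zero    eq = eq
    fuel-spent (suc m) {i} eq = burn-zero (c (m + i)) (fuel-spent m eq)

    burn-false : ∀ e → burn false e ≡ e ∸ 1
    burn-false zero    = refl
    burn-false (suc e) = refl

    Gap : ℕ → Set
    Gap p = ∀ j → j < k → c (j + p) ≡ false

    gap⇒spent : ∀ {p} → Gap p → fuel c (k + p) ≡ 0
    gap⇒spent {p} gap = n≤0⇒n≡0 (subst (fuel c (k + p) ≤_) (n∸n≡0 k) (go k ≤-refl))
      where
      go : ∀ j → j ≤ k → fuel c (j + p) ≤ k ∸ j
      go zero    _   = fuel≤k p
      go (suc j) j<k rewrite gap j j<k | burn-false (fuel c (j + p)) = ≤-trans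
        (∸-monoˡ-≤ 1 (go j (<⇒≤ j<k)))
        (≤-reflexive (trans (∸-+-assoc k j 1) (cong (k ∸_) (+-comm j 1))))

    spent⇒gap : ∀ i → fuel c i ≡ 0 → ∃[ p ] Gap p
    spent⇒gap i spent = [ id , (λ (s , _ , s+k , clear) → s , λ j j<k →
        clear (j + s) (m≤n+m s j) (subst (j + s <_)
          (trans s+k (trans (cong (i +_) spent) (+-identityʳ i))) (+-monoˡ-< s j<k))) ]′ (go i)
      where
      -- As long as no gap has been found, `s` is the start of the current run without tokens, and
      -- fuel plus the length of the run is `k`.
      go : ∀ i → (∃[ p ] Gap p) ⊎
           (∃[ s ] s ≤ i × k + s ≡ i + fuel c i × (∀ m → s ≤ m → m < i → c m ≡ false))
      go zero = inj₂ (0 , z≤n , +-identityʳ k , λ _ _ ())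
      go (suc i) with go i
      ... | inj₁ gap = inj₁ gap
      ... | inj₂ (s , s≤i , s+k , clear) with fuel c i | c i in eq
      ...   | zero  | _     = inj₁ (s , λ j j<k → clear (j + s) (m≤n+m s j)
                                (subst (j + s <_) (trans s+k (+-identityʳ i)) (+-monoˡ-< s j<k)))
      ...   | suc e | true  = inj₂ (suc i , ≤-refl , +-comm k (suc i) ,
                                λ m i<m m≤i → contradiction i<m (≤⇒≯ (≤-pred m≤i)))
      ...   | suc e | false = inj₂ (s , m≤n⇒m≤1+n s≤i , trans s+k (+-suc i e) , clear′)
        where
        clear′ : ∀ m → s ≤ m → m < suc i → c m ≡ false
        clear′ m s≤m (s≤s m≤i) with m≤n⇒m<n∨m≡n m≤i
        ... | inj₁ m<i  = clear m s≤m m<i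
        ... | inj₂ refl = eq

-- Execution of programs

≡suc⇒≢0 : ∀ {m p} → m ≡ suc p → m ≢ 0
≡suc⇒≢0 refl ()

-- Total correctness with an upper bound on the cost, so that branches of different length share one
-- bound.
Runs : Program → State → ℕ → (State → Set) → Set
Runs P σ c Post = ∃[ τ ] ∃[ t ] ⟨ P , σ ⟩⇓ τ in[ t ] × t ≤ c × Post τ

runs-⨾ : ∀ {P Q σ c d Mid Post} → Runs P σ c Mid → (∀ {τ} → Mid τ → Runs Q τ d Post) →
         Runs (P ⨾ Q) σ (c + d) Post
runs-⨾ (τ , s , P⇓ , s≤c , mid) runs-Q with υ , t , Q⇓ , t≤d , post ← runs-Q mid =
  υ , s + t , ⇓seq P⇓ Q⇓ , +-mono-≤ s≤c t≤d , post

runs-≤ : ∀ {P σ c d Post} → c ≤ d → Runs P σ c Post → Runs P σ d Post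
runs-≤ c≤d (τ , t , P⇓ , t≤c , post) = τ , t , P⇓ , ≤-trans t≤c c≤d , post

target : Instr → ℕ → Bool
target (const r m)   j = j ≡ᵇ r
target (move r s)    j = j ≡ᵇ r
target (inc r)       j = j ≡ᵇ r
target (sub r s t)   j = j ≡ᵇ r
target (load r a s)  j = j ≡ᵇ r
target (store a s r) j = false

-- A syntactic overestimate that computes on concrete programs, so that most framing conditions are
-- closed by `refl`.
writes : Program → ℕ → Bool
writes skip                        j = false
writes (instr c)                   j = target c j
writes (P ⨾ Q)                     j = writes P j ∨ writes Q j
writes (ifNonZero r then P else Q) j = writes P j ∨ writes Q j
writes (whileNonZero r loop P)     j = writes P j

exec-frame : ∀ c {σ j} → target c j ≡ false → reg (exec c σ) j ≡ reg σ j
exec-frame (const r m)   eq rewrite eq = refl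
exec-frame (move r s)    eq rewrite eq = refl
exec-frame (inc r)       eq rewrite eq = refl
exec-frame (sub r s t)   eq rewrite eq = refl
exec-frame (load r a s)  eq rewrite eq = refl
exec-frame (store a s r) eq = refl

frame : ∀ {P σ τ t} → ⟨ P , σ ⟩⇓ τ in[ t ] → ∀ {j} → writes P j ≡ false → reg τ j ≡ reg σ j
frame ⇓skip _ = refl
frame (⇓instr {c = c}) eq = exec-frame c eq
frame {P ⨾ Q} (⇓seq p q) eq =
  trans (frame q (Boolₚ.∨-conicalʳ (writes P _) _ eq)) (frame p (Boolₚ.∨-conicalˡ (writes P _) _ eq))
frame {ifNonZero r then P else Q} (⇓then _ p) eq = frame p (Boolₚ.∨-conicalˡ (writes P _) _ eq)
frame {ifNonZero r then P else Q} (⇓else _ q) eq = frame q (Boolₚ.∨-conicalʳ (writes P _) _ eq)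
frame (⇓loop _ p q) eq = trans (frame q eq) (frame p eq)
frame (⇓exit _) _ = refl

isStore : Instr → Bool
isStore (store _ _ _) = true
isStore _             = false

stores : Program → Bool
stores skip                        = false
stores (instr c)                   = isStore c
stores (P ⨾ Q)                     = stores P ∨ stores Q
stores (ifNonZero r then P else Q) = stores P ∨ stores Q
stores (whileNonZero r loop P)     = stores P

exec-arr : ∀ c {σ} → isStore c ≡ false → arr (exec c σ) ≡ arr σ
exec-arr (const r m)  _ = refl
exec-arr (move r s)   _ = refl
exec-arr (inc r)      _ = refl
exec-arr (sub r s t)  _ = refl
exec-arr (load r a s) _ = refl

arr-frame : ∀ {P σ τ t} → ⟨ P , σ ⟩⇓ τ in[ t ] → stores P ≡ false → arr τ ≡ arr σ
arr-frame ⇓skip _ = refl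
arr-frame (⇓instr {c = c}) eq = exec-arr c eq
arr-frame {P ⨾ Q} (⇓seq p q) eq =
  trans (arr-frame q (Boolₚ.∨-conicalʳ (stores P) _ eq)) (arr-frame p (Boolₚ.∨-conicalˡ (stores P) _ eq))
arr-frame {ifNonZero r then P else Q} (⇓then _ p) eq = arr-frame p (Boolₚ.∨-conicalˡ (stores P) _ eq)
arr-frame {ifNonZero r then P else Q} (⇓else _ q) eq = arr-frame q (Boolₚ.∨-conicalʳ (stores P) _ eq)
arr-frame (⇓loop _ p q) eq = trans (arr-frame q eq) (arr-frame p eq)
arr-frame (⇓exit _) _ = refl

Unchanged : Program → State → State → Set
Unchanged P σ τ = arr τ ≡ arr σ × (∀ {j} → writes P j ≡ false → reg τ j ≡ reg σ j)

framed : ∀ {P σ c Post} → stores P ≡ false → Runs P σ c Post →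
         Runs P σ c (λ τ → Post τ × Unchanged P σ τ)
framed no-store (τ , t , P⇓ , t≤c , post) = τ , t , P⇓ , t≤c , post , arr-frame P⇓ no-store , frame P⇓

-- Registers: 0 n, later the answer; 1 u; 2 the constant 1; 3 steps left; 4 and 5 the
-- current and the previous vertex; 6, 7, 8, 16, 17 scratch; 9 and 10 `life` and `life₂`;
-- 11 `crowdFlag`; 12 `tally`; 13 `fuel`; 14 some cover is too large; 15 some cover is stuck.
module Bodies (k : ℕ) where

  open Counters k using (mark; burn)

  -- Two truncated differences test the first neighbour against the previous vertex; the second
  -- neighbour is loaded only if both vanish.
  advance : Program
  advance =
    instr (load 6 2 4) ⨾
    instr (sub 7 6 5) ⨾
    instr (sub 8 5 6) ⨾
    (ifNonZero 7 then skip else ifNonZero 8 then skip else instr (load 6 3 4)) ⨾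
    instr (move 5 4) ⨾
    instr (move 4 6) ⨾
    instr (sub 3 3 2)

  private
    ∸≡0∧∸≡0⇒≡ : ∀ m n → m ∸ n ≡ 0 → n ∸ m ≡ 0 → m ≡ n
    ∸≡0∧∸≡0⇒≡ m n p q = ≤-antisym (m∸n≡0⇒m≤n p) (m∸n≡0⇒m≤n q)

    m∸m≡0 : ∀ {m n} → m ≡ n → m ∸ n ≡ 0
    m∸m≡0 {m} refl = n∸n≡0 m

  Advanced : State → ℕ → State → Set
  Advanced σ next τ = reg τ 4 ≡ next × reg τ 5 ≡ reg σ 4 × reg τ 3 ≡ reg σ 3 ∸ reg σ 2

  advance-keeps : ∀ σ → arr σ 2 (reg σ 4) ≢ reg σ 5 → Runs advance σ 9 (Advanced σ (arr σ 2 (reg σ 4)))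
  advance-keeps σ ≢ with arr σ 2 (reg σ 4) ∸ reg σ 5 ≟ 0 | reg σ 5 ∸ arr σ 2 (reg σ 4) ≟ 0
  ... | yes p  | yes q  = contradiction (∸≡0∧∸≡0⇒≡ _ (reg σ 5) p q) ≢
  ... | no ¬p  | _      = _ , _ , ⇓seq ⇓instr (⇓seq ⇓instr (⇓seq ⇓instr (⇓seq (⇓then ¬p ⇓skip)
          (⇓seq ⇓instr (⇓seq ⇓instr ⇓instr))))) , ≤ᵇ⇒≤ _ _ _ , refl , refl , refl
  ... | yes p  | no ¬q  = _ , _ , ⇓seq ⇓instr (⇓seq ⇓instr (⇓seq ⇓instr (⇓seq (⇓else p (⇓then ¬q ⇓skip))
          (⇓seq ⇓instr (⇓seq ⇓instr ⇓instr))))) , ≤ᵇ⇒≤ _ _ _ , refl , refl , refl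

  advance-switches : ∀ σ → arr σ 2 (reg σ 4) ≡ reg σ 5 → Runs advance σ 9 (Advanced σ (arr σ 3 (reg σ 4)))
  advance-switches σ eq =
    _ , _ , ⇓seq ⇓instr (⇓seq ⇓instr (⇓seq ⇓instr (⇓seq
      (⇓else (m∸m≡0 eq) (⇓else (m∸m≡0 (sym eq)) ⇓instr))
      (⇓seq ⇓instr (⇓seq ⇓instr ⇓instr))))) , ≤ᵇ⇒≤ _ _ _ , refl , refl , refl

  track : ℕ → Program
  track x =
    instr (load 8 x 4) ⨾
    ifNonZero 8
      -- The order matters: register 10 must still describe the tokens before this one when it is
      -- tested, and register 9 must be copied before it is renewed.
      then (ifNonZero 10 then instr (const 11 1) else skip) ⨾
           instr (sub 10 9 2) ⨾ instr (const 9 k) ⨾ instr (inc 12)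
      else (instr (sub 9 9 2) ⨾ instr (sub 10 10 2))

  Tracked : State → Bool → State → Set
  Tracked σ β τ =
    reg τ 9  ≡ (if β then k else reg σ 9 ∸ reg σ 2) ×
    reg τ 10 ≡ (if β then reg σ 9 ∸ reg σ 2 else reg σ 10 ∸ reg σ 2) ×
    reg τ 11 ≡ (if β then mark (reg σ 10) (reg σ 11) else reg σ 11) ×
    reg τ 12 ≡ bit β + reg σ 12

  track-runs : ∀ x σ β → arr σ x (reg σ 4) ≡ bit β → Runs (track x) σ 7 (Tracked σ β)
  track-runs x σ false eq =
    _ , _ , ⇓seq ⇓instr (⇓else eq (⇓seq ⇓instr ⇓instr)) , ≤ᵇ⇒≤ _ _ _ , refl , refl , refl , refl
  track-runs x σ true  eq with reg σ 10 in eq₁₀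
  ... | zero  = _ , _ , ⇓seq ⇓instr (⇓then (≡suc⇒≢0 eq) (⇓seq (⇓else eq₁₀ ⇓skip)
                  (⇓seq ⇓instr (⇓seq ⇓instr ⇓instr)))) , ≤ᵇ⇒≤ _ _ _ , refl , refl , refl , refl
  ... | suc m = _ , _ , ⇓seq ⇓instr (⇓then (≡suc⇒≢0 eq) (⇓seq (⇓then (≡suc⇒≢0 eq₁₀) ⇓instr)
                  (⇓seq ⇓instr (⇓seq ⇓instr ⇓instr)))) , ≤ᵇ⇒≤ _ _ _ , refl , refl , refl , refl

  consume : Program
  consume =
    instr (load 8 0 4) ⨾
    instr (load 16 1 4) ⨾
    ifNonZero 13
      then (ifNonZero 8
        then (ifNonZero 16 then instr (const 13 k) else instr (sub 13 13 2))
        else instr (sub 13 13 2))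
      else skip

  consume-runs : ∀ σ β γ → reg σ 2 ≡ 1 → arr σ 0 (reg σ 4) ≡ bit β → arr σ 1 (reg σ 4) ≡ bit γ →
                 Runs consume σ 6 (λ τ → reg τ 13 ≡ burn (β ∧ γ) (reg σ 13))
  consume-runs σ β γ one eqβ eqγ with reg σ 13 in eq₁₃
  ... | zero = _ , _ , ⇓seq ⇓instr (⇓seq ⇓instr (⇓else eq₁₃ ⇓skip)) , ≤ᵇ⇒≤ _ _ _ , eq₁₃
  consume-runs σ false γ one eqβ eqγ | suc m =
    _ , _ , ⇓seq ⇓instr (⇓seq ⇓instr (⇓then (≡suc⇒≢0 eq₁₃) (⇓else eqβ ⇓instr))) ,
    ≤ᵇ⇒≤ _ _ _ , cong₂ _∸_ eq₁₃ one
  consume-runs σ true false one eqβ eqγ | suc m =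
    _ , _ , ⇓seq ⇓instr (⇓seq ⇓instr (⇓then (≡suc⇒≢0 eq₁₃)
      (⇓then (≡suc⇒≢0 eqβ) (⇓else eqγ ⇓instr)))) , ≤ᵇ⇒≤ _ _ _ , cong₂ _∸_ eq₁₃ one
  consume-runs σ true true one eqβ eqγ | suc m =
    _ , _ , ⇓seq ⇓instr (⇓seq ⇓instr (⇓then (≡suc⇒≢0 eq₁₃)
      (⇓then (≡suc⇒≢0 eqβ) (⇓then (≡suc⇒≢0 eqγ) ⇓instr)))) , ≤ᵇ⇒≤ _ _ _ , refl

array-toℕ : ∀ {n} (f : Fin n → ℕ) v → array f (toℕ v) ≡ f v
array-toℕ {n} f v with toℕ v <? n
... | yes v<n = cong f (Finₚ.fromℕ<-toℕ v v<n)
... | no  v≮n = contradiction (Finₚ.toℕ<n v) v≮n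

runs-linear : ∀ {P σ Post} c n .{{_ : NonZero n}} → Runs P σ c Post → Runs P σ (c * n) Post
runs-linear c n = runs-≤ (m≤m*n c n)

runs-⨾-linear : ∀ {P Q σ Mid Post} c d n → Runs P σ (c * n) Mid →
                (∀ {τ} → Mid τ → Runs Q τ (d * n) Post) → Runs (P ⨾ Q) σ ((c + d) * n) Post
runs-⨾-linear c d n runs-P runs-Q = runs-≤ (≤-reflexive (sym (*-distribʳ-+ n c d))) (runs-⨾ runs-P runs-Q)

-- The decision program

module Programs (k : ℕ) where
  open Bodies k public

  pass : Program → Program
  pass Q = instr (move 3 0) ⨾ whileNonZero 3 loop (Q ⨾ advance)

  twiceRound : Program → Program
  -- The first neighbour of vertex 0 is declared to be the previous vertex, so the walk sets out
  -- towards the other one.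
  twiceRound Q = (instr (const 4 0) ⨾ instr (load 5 2 4)) ⨾ pass Q ⨾ pass Q

  reset : Program
  reset = instr (const 9 0) ⨾ instr (const 10 0) ⨾ instr (const 11 0) ⨾ instr (const 12 0)

  -- Two turns count every token twice, hence the comparison with u + u.  With one more
  -- than the count, it succeeds for sizes below u, or equal to u if `crowdFlag` is set.
  assess : Program
  assess =
    instr (sub 6 12 1) ⨾
    instr (sub 6 6 1) ⨾
    (ifNonZero 6 then instr (const 14 1) else skip) ⨾
    instr (inc 12) ⨾
    instr (sub 6 12 1) ⨾
    instr (sub 6 6 1) ⨾
    instr (sub 6 6 11) ⨾
    (ifNonZero 6 then instr (const 15 1) else skip)

  analyse : ℕ → Program
  analyse x = reset ⨾ twiceRound (track x) ⨾ assess

  compareCovers : Program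
  compareCovers = instr (const 13 k) ⨾ twiceRound consume

  -- Its argument is unrolled into the program text. Register 17 ends at 0 exactly if the total
  -- subtracted reaches its initial value, and the product is never formed.
  repeatSub : ℕ → Program
  repeatSub zero    = skip
  repeatSub (suc m) = instr (sub 17 17 16) ⨾ repeatSub m

  -- Registers 7, 6 and 17 receive k ∸ n, u ∸ 2 and (n + 1) ∸ k (u ∸ 1).
  prepare : Program
  prepare =
    instr (const 7 k) ⨾
    instr (sub 7 7 0) ⨾
    instr (const 6 2) ⨾
    instr (sub 6 1 6) ⨾
    instr (sub 16 1 2) ⨾
    instr (move 17 0) ⨾
    instr (inc 17) ⨾
    repeatSub k

  yes! no! : Program
  yes! = instr (const 0 1)
  no!  = instr (const 0 0)

  -- Sizes are tested first, since a cover that is too large admits no sequence at all, not even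
  -- from itself to itself. The test for `n < k` precedes the one for a common subcover because for
  -- such `n` the fuel may run out although every set is a cover.
  decide : Program
  decide =
    ifNonZero 14 then no!
    else ifNonZero 7 then yes!
    else ifNonZero 13 then yes!
    else ifNonZero 15 then no!
    else ifNonZero 6 then (ifNonZero 17 then no! else yes!)
    else yes!

  program : Program
  program = instr (const 2 1) ⨾ analyse 0 ⨾ analyse 1 ⨾ compareCovers ⨾ prepare ⨾ decide

-- The machine's walk and a rule for its loops

module Execution {k : ℕ} (X : CycleInstance k) where
  open CycleInstance X
  open Programs k
  open Counters k

  instance
    n≢0 : NonZero n
    n≢0 = >-nonZero (≤-trans (s≤s z≤n) (IsCycle.3≤n isCycle))

  first : Fin n
  first = fromℕ< (>-nonZero⁻¹ n)

  next : Fin n → Fin n → Fin n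
  next p c with nb₁ lists c Finₚ.≟ p
  ... | yes _ = nb₂ lists c
  ... | no  _ = nb₁ lists c

  -- Started one vertex early so that the previous vertex is always defined: the vertex visited at
  -- time `i` is `walk (suc i)`.
  walk : ℕ → Fin n
  walk 0             = nb₁ lists first
  walk 1             = first
  walk (suc (suc i)) = next (walk i) (walk (suc i))

  record Ready (σ : State) : Set where
    constructor ready
    field
      arrays≡ : arr σ ≡ arr (inputState X)
      size≡   : reg σ 0 ≡ n
      budget≡ : reg σ 1 ≡ u
      one≡    : reg σ 2 ≡ 1

  open Ready

  ready-unchanged : ∀ P {σ τ} → Unchanged P σ τ →
    writes P 0 ≡ false → writes P 1 ≡ false → writes P 2 ≡ false → Ready σ → Ready τ
  ready-unchanged _ (arr≡ , reg≡) w₀ w₁ w₂ (ready a n u o) =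
    ready (trans arr≡ a) (trans (reg≡ w₀) n) (trans (reg≡ w₁) u) (trans (reg≡ w₂) o)

  record OnWalk (i : ℕ) (σ : State) : Set where
    constructor onWalk
    field
      isReady  : Ready σ
      current  : reg σ 4 ≡ toℕ (walk (suc i))
      previous : reg σ 5 ≡ toℕ (walk i)

  open OnWalk

  lookup-array : ∀ {σ x m} {f : Fin n → ℕ} {v} → Ready σ → arr (inputState X) x ≡ array f →
                 m ≡ toℕ v → arr σ x m ≡ f v
  lookup-array {x = x} {f = f} {v} r eq refl =
    trans (cong (λ a → a x (toℕ v)) (arrays≡ r)) (trans (cong (λ a → a (toℕ v)) eq) (array-toℕ f v))

  advance-runs : ∀ {i σ} → OnWalk i σ → Runs advance σ 9 λ τ →
    (OnWalk (suc i) τ × reg τ 3 ≡ reg σ 3 ∸ 1) × Unchanged advance σ τ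
  advance-runs {i} {σ} on@(onWalk rdy cur prev) = finish (framed refl steps)
    where
    v = walk (suc i)
    steps : Runs advance σ 9 (Advanced σ (toℕ (walk (suc (suc i)))))
    steps with nb₁ lists v Finₚ.≟ walk i
    ... | yes eq = subst (λ m → Runs advance σ 9 (Advanced σ m)) (lookup-array rdy refl cur)
            (advance-switches σ (trans (lookup-array rdy refl cur) (trans (cong toℕ eq) (sym prev))))
    ... | no  ≢  = subst (λ m → Runs advance σ 9 (Advanced σ m)) (lookup-array rdy refl cur)
            (advance-keeps σ λ eq → ≢ (Finₚ.toℕ-injective
              (trans (sym (lookup-array rdy refl cur)) (trans eq prev))))
    finish : Runs advance σ 9 (λ τ → Advanced σ (toℕ (walk (suc (suc i)))) τ × Unchanged advance σ τ) →
             Runs advance σ 9 (λ τ → (OnWalk (suc i) τ × reg τ 3 ≡ reg σ 3 ∸ 1) × Unchanged advance σ τ)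
    finish (τ , t , ⇓ , t≤ , (cur′ , prev′ , cnt) , same) =
      τ , t , ⇓ , t≤ , (onWalk (ready-unchanged advance same refl refl refl rdy) cur′ (trans prev′ cur) ,
        trans cnt (cong (reg σ 3 ∸_) (one≡ rdy))) , same

  -- A loop rule shared by all passes. The body leaves registers 0 to 5 alone, `advance` writes only
  -- 3 to 8, and the invariant depends on registers from 9 on, so walking and counting do not
  -- interfere.
  module _ {Q : Program} {c : ℕ} {Inv : ℕ → State → Set}
           (pure : stores Q ≡ false)
           (keeps : ∀ (j : Fin 6) → writes Q (toℕ j) ≡ false)
           (stable : ∀ {i σ τ} → (∀ j → reg τ (9 + j) ≡ reg σ (9 + j)) → Inv i σ → Inv i τ)
           (body : ∀ {i σ} → OnWalk i σ → Inv i σ → Runs Q σ c (Inv (suc i)))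
           where

    private
      kept : ∀ {i σ τ} → Unchanged Q σ τ → OnWalk i σ → OnWalk i τ
      kept same@(_ , reg≡) (onWalk rdy cur prev) = onWalk
        (ready-unchanged Q same (keeps zero) (keeps (suc zero)) (keeps (suc (suc zero))) rdy)
        (trans (reg≡ (keeps (suc (suc (suc (suc zero)))))) cur)
        (trans (reg≡ (keeps (suc (suc (suc (suc (suc zero))))))) prev)

      Here : ℕ → State → Set
      Here i σ = OnWalk i σ × Inv i σ

      iteration : ∀ {i σ} → Here i σ →
        Runs (Q ⨾ advance) σ (c + 9) (λ τ → Here (suc i) τ × reg τ 3 ≡ reg σ 3 ∸ 1)
      iteration {i} {σ} (on , inv) = runs-⨾ (framed pure (body on inv)) after
        where
        after : ∀ {τ} → Inv (suc i) τ × Unchanged Q σ τ →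
                Runs advance τ 9 (λ υ → Here (suc i) υ × reg υ 3 ≡ reg σ 3 ∸ 1)
        after (inv′ , same@(_ , reg≡)) with advance-runs (kept same on)
        ... | υ , t , ⇓ , t≤ , (on′ , cnt) , _ , reg≡′ =
              υ , t , ⇓ , t≤ , (on′ , stable (λ j → reg≡′ refl) inv′) ,
              trans cnt (cong (_∸ 1) (reg≡ (keeps (suc (suc (suc zero))))))

      iterations : ∀ m {i σ} → reg σ 3 ≡ m → Here i σ →
             Runs (whileNonZero 3 loop (Q ⨾ advance)) σ (m * (10 + c) + 1) (Here (m + i))
      iterations zero    eq holds = _ , 1 , ⇓exit eq , ≤-refl , holds
      iterations (suc m) {i} {σ} eq holds
        with τ , s , ⇓body , s≤ , holds′ , cnt ← iteration holds
        with υ , t , ⇓rest , t≤ , holds″ ← iterations m (trans cnt (cong (_∸ 1) eq)) holds′ =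
        υ , suc (s + t) , ⇓loop (≡suc⇒≢0 eq) ⇓body ⇓rest ,
        ≤-trans (s≤s (+-mono-≤ (≤-trans s≤ (≤-reflexive (+-comm c 9))) t≤))
          (≤-reflexive (sym (+-assoc (10 + c) (m * (10 + c)) 1))) ,
        subst (λ i → Here i υ) (+-suc m i) holds″

    pass-runs : ∀ {i σ} → Here i σ → Runs (pass Q) σ ((12 + c) * n) (Here (n + i))
    pass-runs {i} {σ} (on@(onWalk rdy cur prev) , inv) = runs-≤ cost
      (runs-⨾ {c = 1} {Mid = λ τ → τ ≡ exec (move 3 0) σ}
        (exec (move 3 0) σ , 1 , ⇓instr , ≤-refl , refl)
        λ { refl → iterations n (size≡ rdy)
              (onWalk (ready (arrays≡ rdy) (size≡ rdy) (budget≡ rdy) (one≡ rdy)) cur prev ,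
               stable (λ _ → refl) inv) })
      where
      -- The initial move and the final loop test cost 2 together, absorbed as `2 * n` because `n`
      -- is positive.
      cost : 1 + (n * (10 + c) + 1) ≤ (12 + c) * n
      cost = begin
        1 + (n * (10 + c) + 1)  ≡⟨ cong suc (+-comm (n * (10 + c)) 1) ⟩
        2 + n * (10 + c)        ≤⟨ +-monoˡ-≤ (n * (10 + c)) (m≤m*n 2 n) ⟩
        2 * n + n * (10 + c)    ≡⟨ cong (2 * n +_) (*-comm n (10 + c)) ⟩
        2 * n + (10 + c) * n    ≡⟨ *-distribʳ-+ n 2 (10 + c) ⟨
        (12 + c) * n            ∎
        where open ≤-Reasoning

    twiceRound-runs : ∀ {σ} → Ready σ → Inv 0 σ →
                      Runs (twiceRound Q) σ ((2 + ((12 + c) + (12 + c))) * n) (Inv (n + n))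
    twiceRound-runs {σ} rdy inv =
      runs-⨾-linear {Mid = Here 0} 2 ((12 + c) + (12 + c)) n
        (runs-linear 2 n (_ , _ , ⇓seq ⇓instr ⇓instr , ≤-refl , start , stable (λ _ → refl) inv))
        λ holds → runs-⨾-linear (12 + c) (12 + c) n (pass-runs holds) λ holds′ →
          weaken (pass-runs holds′)
      where
      start : OnWalk 0 (exec (load 5 2 4) (exec (const 4 0) σ))
      start = onWalk (ready (arrays≡ rdy) (size≡ rdy) (budget≡ rdy) (one≡ rdy))
        (sym (Finₚ.toℕ-fromℕ< (>-nonZero⁻¹ n)))
        (lookup-array rdy refl (sym (Finₚ.toℕ-fromℕ< (>-nonZero⁻¹ n))))
      weaken : ∀ {τ d} → Runs (pass Q) τ d (Here (n + (n + 0))) → Runs (pass Q) τ d (Inv (n + n))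
      weaken (υ , t , ⇓ , t≤ , _ , inv′) =
        υ , t , ⇓ , t≤ , subst (λ i → Inv i υ) (cong (n +_) (+-identityʳ n)) inv′

runs-map : ∀ {P σ c Post Post′} → (∀ {τ} → Post τ → Post′ τ) → Runs P σ c Post → Runs P σ c Post′
runs-map f (τ , t , P⇓ , t≤c , post) = τ , t , P⇓ , t≤c , f post

cong₃ : ∀ {A B C D : Set} (f : A → B → C → D) {a a′ b b′ c c′} →
        a ≡ a′ → b ≡ b′ → c ≡ c′ → f a b c ≡ f a′ b′ c′
cong₃ f refl refl refl = refl

-- What each phase computes and costs

module Phases {k : ℕ} (X : CycleInstance k) where
  open CycleInstance X
  open Programs k
  open Counters k
  open Execution X
  open Ready
  open OnWalk

  tokens : Subset n → ℕ → Bool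
  tokens A i = lookup A (walk (suc i))

  TrackInv : (ℕ → Bool) → ℕ → State → Set
  TrackInv b i σ = reg σ 9 ≡ life b i × reg σ 10 ≡ life₂ b i ×
                   reg σ 11 ≡ crowdFlag b i × reg σ 12 ≡ tally b i

  module _ {x : ℕ} {A : Subset n} (stored : arr (inputState X) x ≡ array (bit ∘ lookup A)) where

    track-body : ∀ {i σ} → OnWalk i σ → TrackInv (tokens A) i σ →
                 Runs (track x) σ 7 (TrackInv (tokens A) (suc i))
    track-body {i} {σ} (onWalk rdy cur _) (e₉ , e₁₀ , e₁₁ , e₁₂) = runs-map
      (λ (e₉′ , e₁₀′ , e₁₁′ , e₁₂′) →
        trans e₉′ (cong₂ (λ p q → if β then k else p ∸ q) e₉ (one≡ rdy)) ,
        trans e₁₀′ (cong₃ (λ p q o → if β then p ∸ o else q ∸ o) e₉ e₁₀ (one≡ rdy)) ,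
        trans e₁₁′ (cong₂ (λ p q → if β then mark p q else q) e₁₀ e₁₁) ,
        trans e₁₂′ (cong (bit β +_) e₁₂))
      (track-runs x σ β (lookup-array rdy stored cur))
      where
      β = tokens A i

    sweep-runs : ∀ {σ} → Ready σ → TrackInv (tokens A) 0 σ →
                 Runs (twiceRound (track x)) σ (40 * n) (TrackInv (tokens A) (n + n))
    sweep-runs = twiceRound-runs refl (from-yes (Finₚ.all? {n = 6} λ j → writes (track x) (toℕ j) Boolₚ.≟ false))
      (λ same (e₉ , e₁₀ , e₁₁ , e₁₂) → trans (same 0) e₉ , trans (same 1) e₁₀ ,
                                         trans (same 2) e₁₁ , trans (same 3) e₁₂)
      track-body

    Assessed : (m f : ℕ) → State → State → Set
    Assessed m f σ τ =
      reg τ 14 ≡ mark (m ∸ u ∸ u) (reg σ 14) ×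
      reg τ 15 ≡ mark (suc m ∸ u ∸ u ∸ f) (reg σ 15)

    assess-runs : ∀ σ → Runs assess σ 14 λ τ →
      reg τ 14 ≡ mark (reg σ 12 ∸ reg σ 1 ∸ reg σ 1) (reg σ 14) ×
      reg τ 15 ≡ mark (suc (reg σ 12) ∸ reg σ 1 ∸ reg σ 1 ∸ reg σ 11) (reg σ 15)
    assess-runs σ
      with reg σ 12 ∸ reg σ 1 ∸ reg σ 1 in e
         | suc (reg σ 12) ∸ reg σ 1 ∸ reg σ 1 ∸ reg σ 11 in e′
    ... | zero  | zero  = _ , _ ,
          ⇓seq ⇓instr (⇓seq ⇓instr (⇓seq (⇓else e ⇓skip) (⇓seq ⇓instr (⇓seq ⇓instr
            (⇓seq ⇓instr (⇓seq ⇓instr (⇓else e′ ⇓skip))))))) ,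
          ≤ᵇ⇒≤ _ _ _ , refl , refl
    ... | zero  | suc _ = _ , _ ,
          ⇓seq ⇓instr (⇓seq ⇓instr (⇓seq (⇓else e ⇓skip) (⇓seq ⇓instr (⇓seq ⇓instr
            (⇓seq ⇓instr (⇓seq ⇓instr (⇓then (≡suc⇒≢0 e′) ⇓instr))))))) ,
          ≤ᵇ⇒≤ _ _ _ , refl , refl
    ... | suc _ | zero  = _ , _ ,
          ⇓seq ⇓instr (⇓seq ⇓instr (⇓seq (⇓then (≡suc⇒≢0 e) ⇓instr) (⇓seq ⇓instr (⇓seq ⇓instr
            (⇓seq ⇓instr (⇓seq ⇓instr (⇓else e′ ⇓skip))))))) ,
          ≤ᵇ⇒≤ _ _ _ , refl , refl
    ... | suc _ | suc _ = _ , _ ,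
          ⇓seq ⇓instr (⇓seq ⇓instr (⇓seq (⇓then (≡suc⇒≢0 e) ⇓instr) (⇓seq ⇓instr (⇓seq ⇓instr
            (⇓seq ⇓instr (⇓seq ⇓instr (⇓then (≡suc⇒≢0 e′) ⇓instr))))))) ,
          ≤ᵇ⇒≤ _ _ _ , refl , refl

    analyse-runs : ∀ {σ} → Ready σ → Runs (analyse x) σ (58 * n) λ τ →
      Ready τ × Assessed (tally (tokens A) (n + n)) (crowdFlag (tokens A) (n + n)) σ τ
    analyse-runs {σ} rdy = runs-map
      (λ (assessed , same) → ready-unchanged (analyse x) same refl refl refl rdy , assessed)
      (framed refl
        (runs-⨾-linear {Mid = AfterReset} 4 54 n
          (runs-linear 4 n (_ , _ , ⇓seq ⇓instr (⇓seq ⇓instr (⇓seq ⇓instr ⇓instr)) , ≤ᵇ⇒≤ _ _ _ ,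
            ready (arrays≡ rdy) (size≡ rdy) (budget≡ rdy) (one≡ rdy) ,
            (refl , refl , refl , refl) , refl , refl))
          λ (rdy₁ , inv , e₁₄ , e₁₅) →
            runs-⨾-linear 40 14 n (framed refl (sweep-runs rdy₁ inv))
              λ {τ} ((_ , _ , e₁₁ , e₁₂) , same@(_ , reg≡)) →
                runs-linear 14 n (runs-map
                  (λ (f₁₄ , f₁₅) →
                    trans f₁₄ (cong₃ (λ m u r → mark (m ∸ u ∸ u) r) e₁₂
                      (trans (reg≡ refl) (budget≡ rdy₁)) (trans (reg≡ refl) e₁₄)) ,
                    trans f₁₅ (cong₂ _$_ (cong₃ (λ m u f r → mark (suc m ∸ u ∸ u ∸ f) r) e₁₂
                      (trans (reg≡ refl) (budget≡ rdy₁)) e₁₁) (trans (reg≡ refl) e₁₅)))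
                  (assess-runs τ))))
      where
      AfterReset : State → Set
      AfterReset τ = Ready τ × TrackInv (tokens A) 0 τ × reg τ 14 ≡ reg σ 14 × reg τ 15 ≡ reg σ 15

  shared : ℕ → Bool
  shared i = tokens I i ∧ tokens J i

  compareCovers-runs : ∀ {σ} → Ready σ → Runs compareCovers σ (39 * n) λ τ → reg τ 13 ≡ fuel shared (n + n)
  compareCovers-runs {σ} rdy = runs-⨾-linear {Mid = λ τ → Ready τ × reg τ 13 ≡ k} 1 38 n
    (runs-linear 1 n (_ , _ , ⇓instr , ≤-refl ,
      ready (arrays≡ rdy) (size≡ rdy) (budget≡ rdy) (one≡ rdy) , refl))
    λ (rdy₁ , e₁₃) → twiceRound-runs {c = 6} {Inv = λ i τ → reg τ 13 ≡ fuel shared i}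
      refl (from-yes (Finₚ.all? {n = 6} λ j → writes consume (toℕ j) Boolₚ.≟ false)) (λ same e → trans (same 4) e)
      (λ {i} {τ} (onWalk rdy cur _) e → runs-map (λ e′ → trans e′ (cong (burn (shared i)) e))
        (consume-runs τ (tokens I i) (tokens J i) (one≡ rdy)
          (lookup-array rdy refl cur) (lookup-array rdy refl cur)))
      rdy₁ e₁₃

  repeatSub-runs : ∀ m σ → Runs (repeatSub m) σ (suc m) λ τ → reg τ 17 ≡ reg σ 17 ∸ m * reg σ 16
  repeatSub-runs zero    σ = _ , _ , ⇓skip , ≤-refl , refl
  repeatSub-runs (suc m) σ with τ , t , ⇓ , t≤ , eq ← repeatSub-runs m (exec (sub 17 17 16) σ) =
    τ , suc t , ⇓seq ⇓instr ⇓ , s≤s t≤ , trans eq (∸-+-assoc (reg σ 17) (reg σ 16) (m * reg σ 16))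

  writes-repeatSub : ∀ m j → j ≢ 17 → writes (repeatSub m) j ≡ false
  writes-repeatSub zero    j j≢17 = refl
  writes-repeatSub (suc m) j j≢17 with j ≡ᵇ 17 in eq
  ... | true  = contradiction (≡ᵇ⇒≡ j 17 (subst T (sym eq) tt)) j≢17
  ... | false = writes-repeatSub m j j≢17

  stores-repeatSub : ∀ m → stores (repeatSub m) ≡ false
  stores-repeatSub zero    = refl
  stores-repeatSub (suc m) = stores-repeatSub m

  Prepared : State → State → Set
  Prepared σ τ =
    reg τ 7 ≡ k ∸ n × reg τ 6 ≡ u ∸ 2 × reg τ 17 ≡ suc n ∸ k * (u ∸ 1) ×
    reg τ 13 ≡ reg σ 13 × reg τ 14 ≡ reg σ 14 × reg τ 15 ≡ reg σ 15

  prepare-runs : ∀ {σ} → Ready σ → Runs prepare σ (8 + k) (Prepared σ)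
  prepare-runs {σ} rdy =
    let τ , t , ⇓ , t≤ , eq , _ , same = framed (stores-repeatSub k) (repeatSub-runs k σ₇) in
    τ , _ , ⇓seq ⇓instr (⇓seq ⇓instr (⇓seq ⇓instr (⇓seq ⇓instr (⇓seq ⇓instr (⇓seq ⇓instr (⇓seq ⇓instr ⇓)))))) ,
    +-monoʳ-≤ 7 t≤ ,
    trans (same (other λ ())) (cong (k ∸_) (size≡ rdy)) ,
    trans (same (other λ ())) (cong (_∸ 2) (budget≡ rdy)) ,
    trans eq (cong₂ (λ m d → suc m ∸ k * d) (size≡ rdy) (cong₂ _∸_ (budget≡ rdy) (one≡ rdy))) ,
    same (other λ ()) , same (other λ ()) , same (other λ ())
    where
    other : ∀ {j} → j ≢ 17 → writes (repeatSub k) j ≡ false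
    other = writes-repeatSub k _
    σ₇ : State
    σ₇ = exec (inc 17) (exec (move 17 0) (exec (sub 16 1 2) (exec (sub 6 1 6)
           (exec (const 6 2) (exec (sub 7 7 0) (exec (const 7 k) σ))))))

  Verdict : (over short common stuck few many : ℕ) → Set
  Verdict over short common stuck few many =
    over ≡ 0 × (short ≢ 0 ⊎ common ≢ 0 ⊎ (stuck ≡ 0 × (few ≡ 0 ⊎ many ≡ 0)))

  decide-runs : ∀ σ → Runs decide σ 7 λ τ →
    Answers τ (Verdict (reg σ 14) (reg σ 7) (reg σ 13) (reg σ 15) (reg σ 6) (reg σ 17))
  decide-runs σ with reg σ 14 ≟ 0 | reg σ 7 ≟ 0 | reg σ 13 ≟ 0 | reg σ 15 ≟ 0 | reg σ 6 ≟ 0 | reg σ 17 ≟ 0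
  ... | no ≢₁₄ | _ | _ | _ | _ | _ = _ , _ , ⇓then ≢₁₄ ⇓instr , ≤ᵇ⇒≤ _ _ _ ,
        inj₂ (refl , λ (e , _) → ≢₁₄ e)
  ... | yes e₁₄ | no ≢₇ | _ | _ | _ | _ = _ , _ , ⇓else e₁₄ (⇓then ≢₇ ⇓instr) , ≤ᵇ⇒≤ _ _ _ ,
        inj₁ (refl , e₁₄ , inj₁ ≢₇)
  ... | yes e₁₄ | yes e₇ | no ≢₁₃ | _ | _ | _ =
        _ , _ , ⇓else e₁₄ (⇓else e₇ (⇓then ≢₁₃ ⇓instr)) , ≤ᵇ⇒≤ _ _ _ ,
        inj₁ (refl , e₁₄ , inj₂ (inj₁ ≢₁₃))
  ... | yes e₁₄ | yes e₇ | yes e₁₃ | no ≢₁₅ | _ | _ =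
        _ , _ , ⇓else e₁₄ (⇓else e₇ (⇓else e₁₃ (⇓then ≢₁₅ ⇓instr))) , ≤ᵇ⇒≤ _ _ _ ,
        inj₂ (refl , λ { (_ , inj₁ ≢₇) → ≢₇ e₇ ; (_ , inj₂ (inj₁ ≢₁₃)) → ≢₁₃ e₁₃
                       ; (_ , inj₂ (inj₂ (e₁₅ , _))) → ≢₁₅ e₁₅ })
  ... | yes e₁₄ | yes e₇ | yes e₁₃ | yes e₁₅ | yes e₆ | _ =
        _ , _ , ⇓else e₁₄ (⇓else e₇ (⇓else e₁₃ (⇓else e₁₅ (⇓else e₆ ⇓instr)))) , ≤ᵇ⇒≤ _ _ _ ,
        inj₁ (refl , e₁₄ , inj₂ (inj₂ (e₁₅ , inj₁ e₆)))
  ... | yes e₁₄ | yes e₇ | yes e₁₃ | yes e₁₅ | no ≢₆ | yes e₁₇ =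
        _ , _ , ⇓else e₁₄ (⇓else e₇ (⇓else e₁₃ (⇓else e₁₅ (⇓then ≢₆ (⇓else e₁₇ ⇓instr))))) , ≤ᵇ⇒≤ _ _ _ ,
        inj₁ (refl , e₁₄ , inj₂ (inj₂ (e₁₅ , inj₂ e₁₇)))
  ... | yes e₁₄ | yes e₇ | yes e₁₃ | yes e₁₅ | no ≢₆ | no ≢₁₇ =
        _ , _ , ⇓else e₁₄ (⇓else e₇ (⇓else e₁₃ (⇓else e₁₅ (⇓then ≢₆ (⇓then ≢₁₇ ⇓instr))))) , ≤ᵇ⇒≤ _ _ _ ,
        inj₂ (refl , λ { (_ , inj₁ ≢₇) → ≢₇ e₇ ; (_ , inj₂ (inj₁ ≢₁₃)) → ≢₁₃ e₁₃
                       ; (_ , inj₂ (inj₂ (_ , inj₁ e₆))) → ≢₆ e₆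
                       ; (_ , inj₂ (inj₂ (_ , inj₂ e₁₇))) → ≢₁₇ e₁₇ })

  -- The number is the flag left by the preceding analysis: both covers report to the same two
  -- registers, so nesting these functions expresses a disjunction.
  overFlag stuckFlag : Subset n → ℕ → ℕ
  overFlag A  = mark (tally (tokens A) (n + n) ∸ u ∸ u)
  stuckFlag A = mark (suc (tally (tokens A) (n + n)) ∸ u ∸ u ∸ crowdFlag (tokens A) (n + n))

  verdict : Set
  verdict = Verdict (overFlag J (overFlag I 0)) (k ∸ n) (fuel shared (n + n))
                    (stuckFlag J (stuckFlag I 0)) (u ∸ 2) (suc n ∸ k * (u ∸ 1))

  -- The factor 156 is 1 + 58 + 58 + 39, for the constant, the two analyses and the comparison;
  -- `8 + k` belongs to `prepare` and 7 to `decide`. Fixed costs are charged to every vertex.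
  program-runs : Runs program (inputState X) ((156 + (8 + k + 7)) * n) λ τ → Answers τ verdict
  program-runs =
    runs-⨾-linear {Mid = λ τ → Ready τ × reg τ 14 ≡ 0 × reg τ 15 ≡ 0} 1 (155 + (8 + k + 7)) n
      (runs-linear 1 n (_ , _ , ⇓instr , ≤-refl , ready refl refl refl refl , refl , refl))
    λ (rdy₀ , e₁₄ , e₁₅) → runs-⨾-linear 58 (97 + (8 + k + 7)) n (analyse-runs {A = I} refl rdy₀)
    λ (rdy₁ , f₁₄ , f₁₅) → runs-⨾-linear 58 (39 + (8 + k + 7)) n (analyse-runs {A = J} refl rdy₁)
    λ (rdy₂ , g₁₄ , g₁₅) → runs-⨾-linear 39 (8 + k + 7) n (framed refl (compareCovers-runs rdy₂))
    λ {τ} (h₁₃ , same@(_ , reg≡)) → runs-⨾-linear (8 + k) 7 n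
      (runs-linear (8 + k) n (prepare-runs (ready-unchanged compareCovers same refl refl refl rdy₂)))
    λ {υ} (i₇ , i₆ , i₁₇ , i₁₃ , i₁₄ , i₁₅) → runs-linear 7 n (runs-map
      (λ {φ} → subst (Answers φ) (cong₆ Verdict
        (trans i₁₄ (trans (reg≡ refl) (trans g₁₄ (cong (overFlag J) (trans f₁₄ (cong (overFlag I) e₁₄))))))
        i₇ (trans i₁₃ h₁₃)
        (trans i₁₅ (trans (reg≡ refl) (trans g₁₅ (cong (stuckFlag J) (trans f₁₅ (cong (stuckFlag I) e₁₅))))))
        i₆ i₁₇))
      (decide-runs υ))
    where
    cong₆ : ∀ (f : ℕ → ℕ → ℕ → ℕ → ℕ → ℕ → Set) {a a′ b b′ c c′ d d′ e e′ g g′} →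
            a ≡ a′ → b ≡ b′ → c ≡ c′ → d ≡ d′ → e ≡ e′ → g ≡ g′ → f a b c d e g ≡ f a′ b′ c′ d′ e′ g′
    cong₆ f refl refl refl refl refl refl = refl

-- The verdict agrees with reconfigurability

module Correctness {k : ℕ} (2≤k : 2 ≤ k) (X : CycleInstance k) where
  open CycleInstance X
  open Counters k
  open Execution X
  open Phases X
  open Reconfiguration k C u using (Cover; common-subcover⇒~; ~⇒sequence; sequence⇒~)

  private
    firstEdge : Adj C (walk 0) (walk 1)
    firstEdge = Graph.sym C (Equivalence.from (listed⇔ lists first _) (inj₁ refl))

    W₀ : Winding C
    W₀ = proj₁ (windingAlong isCycle firstEdge)

  -- Both entries of the list are neighbours along the winding, and these two differ because
  -- `3 ≤ n`; so the entry other than the previous vertex is the one ahead. Two consecutive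
  -- positions are carried along, as each step depends on both.
  walk≡ : ∀ i → walk i ≡ Winding.at W₀ i × walk (suc i) ≡ Winding.at W₀ (suc i)
  walk≡ zero with _ , eq₀ , eq₁ ← windingAlong isCycle firstEdge = sym eq₀ , sym eq₁
  walk≡ (suc i) with p≡ , c≡ ← walk≡ i = c≡ , next≡
    where
    open Winding W₀
    2<n : 2 < n
    2<n = IsCycle.3≤n isCycle
    listed : ∀ {v} → Adj C (at (suc i)) v → v ≡ nb₁ lists (walk (suc i)) ⊎ v ≡ nb₂ lists (walk (suc i))
    listed adj = Equivalence.to (listed⇔ lists _ _) (subst (λ c → Adj C c _) (sym c≡) adj)
    differ : at (2 + i) ≢ at i
    differ eq = contradiction (separated i 2 2<n eq) λ ()
    next≡ : next (walk i) (walk (suc i)) ≡ at (2 + i)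
    next≡ with nb₁ lists (walk (suc i)) Finₚ.≟ walk i | listed (Graph.sym C (edge i)) | listed (edge (suc i))
    ... | yes nb₁≡ | _         | inj₁ eq = contradiction (trans eq (trans nb₁≡ p≡)) differ
    ... | yes _    | _         | inj₂ eq = sym eq
    ... | no  _    | _         | inj₁ eq = sym eq
    ... | no  nb₁≢ | inj₁ prev | inj₂ _  = contradiction (trans (sym prev) (sym p≡)) nb₁≢
    ... | no  _    | inj₂ prev | inj₂ eq = contradiction (trans eq (sym prev)) differ

  W : Winding C
  W = shift W₀

  open Winding W
  open Positions W

  walk≡at : ∀ i → walk (suc i) ≡ at i
  walk≡at i = trans (proj₂ (walk≡ i)) (sym (at-shift W₀ i))

  tokens⇒∈ : ∀ {A i} → tokens A i ≡ true → at i ∈ A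
  tokens⇒∈ {A} {i} eq = subst (_∈ A) (walk≡at i) (lookup⇒[]= _ A eq)

  ∈⇒tokens : ∀ {A i} → at i ∈ A → tokens A i ≡ true
  ∈⇒tokens {A} {i} i∈ = []=⇒lookup (subst (_∈ A) (sym (walk≡at i)) i∈)

  tally-tokens : ∀ A → tally (tokens A) (n + n) ≡ ∣ A ∣ + ∣ A ∣
  tally-tokens A = begin
    tally (tokens A) (n + n)                       ≡⟨ tally-cong (n + n) (λ i _ → cong (lookup A) (walk≡at i)) ⟩
    tally (lookup A ∘ at) (n + n)                  ≡⟨ tally-+ (lookup A ∘ at) n n ⟩
    tally (lookup A ∘ at) n + tally (lookup A ∘ at ∘ (n +_)) n
      ≡⟨ cong (tally (lookup A ∘ at) n +_) (tally-cong n λ i _ → cong (lookup A) (periodic i)) ⟩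
    tally (lookup A ∘ at) n + tally (lookup A ∘ at) n
      ≡⟨ cong₂ _+_ (Counting.∣∣≡tally W A) (Counting.∣∣≡tally W A) ⟨
    ∣ A ∣ + ∣ A ∣                                  ∎
    where open ≡-Reasoning

  mark≡0 : ∀ m {f} → mark m f ≡ 0 → m ≡ 0 × f ≡ 0
  mark≡0 zero eq = refl , eq

  not-over⇒ : ∀ A {f} → overFlag A f ≡ 0 → ∣ A ∣ ≤ u × f ≡ 0
  not-over⇒ A eq with e , f≡0 ← mark≡0 (tally (tokens A) (n + n) ∸ u ∸ u) eq =
    ≮⇒≥ (λ u<A → <⇒≱ (+-mono-< u<A u<A) (subst (_≤ u + u) (tally-tokens A)
      (m∸n≡0⇒m≤n (trans (sym (∸-+-assoc _ u u)) e)))) , f≡0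

  ⇒not-over : ∀ A {f} → ∣ A ∣ ≤ u → f ≡ 0 → overFlag A f ≡ 0
  ⇒not-over A A≤u refl = cong (λ m → mark m 0) (trans (∸-+-assoc _ u u)
    (m≤n⇒m∸n≡0 (subst (_≤ u + u) (sym (tally-tokens A)) (+-mono-≤ A≤u A≤u))))

  module _ (k≤n : k ≤ n) where

    v : ℕ
    v = u ∸ 1

    u≡1+v : u ≡ suc v
    u≡1+v = sym (m+[n∸m]≡n 1≤u)

    open Characterisation 2≤k k≤n v W using (Free; Crowded; Roomy; free⇒~; ~⇒free; ~⇒roomy)

    flagged⇒crowded : ∀ {A} → crowdFlag (tokens A) (n + n) ≢ 0 → Crowded A
    flagged⇒crowded flag with p , q , l , p<q , q<l , l≤ , _ , p∈ , q∈ , l∈ ← crowdFlag-sound (n + n) flag =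
      p , q , l , p<q , q<l , l≤ , tokens⇒∈ p∈ , tokens⇒∈ q∈ , tokens⇒∈ l∈

    -- The triple is translated so that its first position falls below `n`. Its extent is at most
    -- `k ≤ n`, so it ends within the second turn.
    crowded⇒flagged : ∀ {A} → Crowded A → crowdFlag (tokens A) (n + n) ≢ 0
    crowded⇒flagged {A} (p , q , l , p<q , q<l , l≤ , p∈ , q∈ , l∈) with r , r<n , at-r ← onto (at p) =
      crowdFlag-complete (n + n) (r , q ∸ p + r , l ∸ p + r ,
        m<n+m r (m<n⇒0<n∸m p<q) , +-monoˡ-< r (∸-monoˡ-< q<l (<⇒≤ p<q)) ,
        +-monoˡ-≤ r l∸p≤k , +-mono-≤-< (≤-trans l∸p≤k k≤n) r<n ,
        ∈⇒tokens (subst (_∈ A) (sym at-r) p∈) , moved (<⇒≤ p<q) q∈ , moved (<⇒≤ (<-trans p<q q<l)) l∈)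
      where
      l∸p≤k : l ∸ p ≤ k
      l∸p≤k = m≤n+o⇒m∸n≤o l p (subst (l ≤_) (+-comm k p) l≤)
      moved : ∀ {m} → p ≤ m → at m ∈ A → tokens A (m ∸ p + r) ≡ true
      moved {m} p≤m m∈ = ∈⇒tokens (subst (_∈ A)
        (sym (trans (at-cong (m ∸ p) at-r) (cong at (m∸n+n≡m p≤m)))) m∈)

    unstuck⇒free : ∀ A {f} → stuckFlag A f ≡ 0 → Free A × f ≡ 0
    unstuck⇒free A eq
      with e , f≡0 ← mark≡0 (suc (tally (tokens A) (n + n)) ∸ u ∸ u ∸ crowdFlag (tokens A) (n + n)) eq
      with crowdFlag (tokens A) (n + n) ≟ 0
    ... | no  flag  = inj₂ (flagged⇒crowded flag) , f≡0
    ... | yes ¬flag = inj₁ (≤-pred (subst (∣ A ∣ <_) u≡1+v (≰⇒> λ u≤A →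
            <⇒≱ (s≤s (+-mono-≤ u≤A u≤A)) (subst (λ m → suc m ≤ u + u) (tally-tokens A)
              (m∸n≡0⇒m≤n (trans (sym (∸-+-assoc _ u u))
                (subst (λ f → suc (tally (tokens A) (n + n)) ∸ u ∸ u ∸ f ≡ 0) ¬flag e))))))) , f≡0

    -- Below the bound, `|A| + 1 ≤ u` and `|A| ≤ u` add up to what is needed. For a crowded cover
    -- the flag, being at least 1, pays for the added 1.
    free⇒unstuck : ∀ A {f} → ∣ A ∣ ≤ u → Free A → f ≡ 0 → stuckFlag A f ≡ 0
    free⇒unstuck A A≤u free refl = cong (λ m → mark m 0)
      (trans (cong (_∸ flag) (trans (∸-+-assoc _ u u) (cong (λ m → suc m ∸ (u + u)) (tally-tokens A))))
        (trans (∸-+-assoc _ (u + u) flag) (m≤n⇒m∸n≡0 bound)))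
      where
      flag = crowdFlag (tokens A) (n + n)
      bound : suc (∣ A ∣ + ∣ A ∣) ≤ u + u + flag
      bound = [ (λ A≤v → m≤n⇒m≤n+o flag (+-mono-≤ (subst (suc ∣ A ∣ ≤_) (sym u≡1+v) (s≤s A≤v)) A≤u))
              , (λ crowded → subst (_≤ u + u + flag) (+-comm (∣ A ∣ + ∣ A ∣) 1)
                  (+-mono-≤ (+-mono-≤ A≤u A≤u) (n≢0⇒n>0 (crowded⇒flagged crowded)))) ]′ free

    roomy⇒ : Roomy → u ∸ 2 ≡ 0 ⊎ suc n ∸ k * (u ∸ 1) ≡ 0
    roomy⇒ (inj₁ v≤1)  = inj₁ (m≤n⇒m∸n≡0 (subst (_≤ 2) (sym u≡1+v) (s≤s v≤1)))
    roomy⇒ (inj₂ n<vk) = inj₂ (m≤n⇒m∸n≡0 (subst (n <_) (*-comm v k) n<vk))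

    ⇒roomy : u ∸ 2 ≡ 0 ⊎ suc n ∸ k * (u ∸ 1) ≡ 0 → Roomy
    ⇒roomy (inj₁ eq) = inj₁ (≤-pred (subst (_≤ 2) u≡1+v (m∸n≡0⇒m≤n eq)))
    ⇒roomy (inj₂ eq) = inj₂ (subst (n <_) (*-comm k v) (m∸n≡0⇒m≤n eq))

    shared≡ : ∀ i → shared i ≡ tokens (I ∩ J) i
    shared≡ i = sym (lookup-zipWith _∧_ (walk (suc i)) I J)

    -- A window that starts below `n` and has no shared token would exhaust the fuel by position
    -- `k + i`, which is within two turns, and exhausted fuel is never restored.
    fuelled⇒common : fuel shared (n + n) ≢ 0 → Cover (I ∩ J)
    fuelled⇒common fuelled = hit⇒cover 2≤k (hit-everywhere hit)
      where
      hit : ∀ i → i < n → Hit k (I ∩ J) i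
      hit i i<n with Finₚ.any? {n = k} (λ j → shared (toℕ j + i) Boolₚ.≟ true)
      ... | yes (j , eq) = toℕ j , Finₚ.toℕ<n j , tokens⇒∈ (trans (sym (shared≡ (toℕ j + i))) eq)
      ... | no  none = contradiction
              (subst (λ m → fuel shared m ≡ 0) (m∸n+n≡m (+-mono-≤ k≤n (<⇒≤ i<n)))
                (fuel-spent (n + n ∸ (k + i)) (gap⇒spent gap)))
              fuelled
        where
        gap : ∀ j → j < k → shared (j + i) ≡ false
        gap j j<k = Boolₚ.¬-not λ eq → none
          (fromℕ< j<k , trans (cong (λ m → shared (m + i)) (Finₚ.toℕ-fromℕ< j<k)) eq)

    spent⇒¬common : fuel shared (n + n) ≡ 0 → ¬ Cover (I ∩ J)
    spent⇒¬common spent cover with p , gap ← spent⇒gap (n + n) spent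
      with j , j<k , j∈ ← cover⇒hit k≤n cover p
      with () ← trans (sym (∈⇒tokens j∈)) (trans (sym (shared≡ (j + p))) (gap j j<k))

    long-verdict⇒ : ∣ I ∣ ≤ u → ∣ J ∣ ≤ u → stuckFlag J (stuckFlag I 0) ≡ 0 →
                    (u ∸ 2 ≡ 0 ⊎ suc n ∸ k * (u ∸ 1) ≡ 0) → ReconfigurableInstance X
    long-verdict⇒ I≤u J≤u unstuck roomy
      with free-J , rest ← unstuck⇒free J unstuck with free-I , _ ← unstuck⇒free I rest =
      ~⇒sequence (coverI , I≤u) (subst (λ u → Reconfiguration._~_ k C u I J) (sym u≡1+v)
        (free⇒~ (coverI , subst (∣ I ∣ ≤_) u≡1+v I≤u) (coverJ , subst (∣ J ∣ ≤_) u≡1+v J≤u)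
          free-I free-J (⇒roomy roomy)))

    ⇒long-verdict : ∣ I ∣ ≤ u → ∣ J ∣ ≤ u → ReconfigurableInstance X → fuel shared (n + n) ≡ 0 →
                    stuckFlag J (stuckFlag I 0) ≡ 0 × (u ∸ 2 ≡ 0 ⊎ suc n ∸ k * (u ∸ 1) ≡ 0)
    ⇒long-verdict I≤u J≤u S spent =
      free⇒unstuck J J≤u
        (~⇒free (¬common ∘ subst Cover (∩-comm J I)) coverJ (Reconfiguration.~-sym k C (suc v) I~J))
        (free⇒unstuck I I≤u (~⇒free ¬common coverI I~J) refl) ,
      roomy⇒ (~⇒roomy ¬common coverI I~J)
      where
      ¬common = spent⇒¬common spent
      I~J : Reconfiguration._~_ k C (suc v) I J
      I~J = subst (λ u → Reconfiguration._~_ k C u I J) u≡1+v (sequence⇒~ S)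

  common⇒reconfigurable : ∣ I ∣ ≤ u → ∣ J ∣ ≤ u → Cover (I ∩ J) → ReconfigurableInstance X
  common⇒reconfigurable I≤u J≤u cover = ~⇒sequence (coverI , I≤u) (common-subcover⇒~ cover I≤u J≤u)

  verdict⇒reconfigurable : verdict → ReconfigurableInstance X
  verdict⇒reconfigurable (not-over , reason)
    with J≤u , rest ← not-over⇒ J not-over with I≤u , _ ← not-over⇒ I rest with n <? k | reason
  ... | yes n<k | _          = common⇒reconfigurable I≤u J≤u (short⇒cover n<k)
  ... | no  n≮k | inj₁ short = contradiction (m≤n⇒m∸n≡0 (≮⇒≥ n≮k)) short
  ... | no  n≮k | inj₂ (inj₁ fuelled) = common⇒reconfigurable I≤u J≤u (fuelled⇒common (≮⇒≥ n≮k) fuelled)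
  ... | no  n≮k | inj₂ (inj₂ (unstuck , roomy)) = long-verdict⇒ (≮⇒≥ n≮k) I≤u J≤u unstuck roomy

  reconfigurable⇒verdict : ReconfigurableInstance X → verdict
  reconfigurable⇒verdict S with I≤u , J≤u ← sequence-bounds S =
    ⇒not-over J J≤u (⇒not-over I I≤u refl) , reason
    where
    reason : k ∸ n ≢ 0 ⊎ fuel shared (n + n) ≢ 0 ⊎
             (stuckFlag J (stuckFlag I 0) ≡ 0 × (u ∸ 2 ≡ 0 ⊎ suc n ∸ k * (u ∸ 1) ≡ 0))
    reason with n <? k | fuel shared (n + n) ≟ 0
    ... | yes n<k | _          = inj₁ (m>n⇒m∸n≢0 n<k)
    ... | no  _   | no fuelled = inj₂ (inj₁ fuelled)
    ... | no  n≮k | yes spent  = inj₂ (inj₂ (⇒long-verdict (≮⇒≥ n≮k) I≤u J≤u S spent))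

theorem9 : (k : ℕ) → 2 ≤ k →
    DecidableInLinearTime {X = CycleInstance k} CycleInstance.n inputState ReconfigurableInstance
theorem9 k 2≤k = Programs.program k , 156 + (8 + k + 7) , λ X →
  let open Correctness 2≤k X
      σ , t , halts , t≤ , answer = Phases.program-runs X
  in σ , t , halts , t≤ , map (λ (one , holds) → one , verdict⇒reconfigurable holds)
                              (λ (none , ¬v) → none , ¬v ∘ reconfigurable⇒verdict) answer
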